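{- Let $n\in\mathbb{P}$, $p\in(0,1)$, $q=1-p$, and let $G$ be an Erdős–Rényi random graph on vertex set $[n]$ with edge probability $p$. Let $|\chi_G(-1)|$ denote the number of acyclic orientations of $G$. Then $$\mathbb{E}\big[|\chi_G(-1)|\big]=q^{\binom n2}\sum_{\mathbf{a}\in\mathrm{Park}_{[n]}}\Big(\frac1q\Big)^{\mathrm{Area}(\mathbf{a})}p^{|\mathrm{supp}(\mathbf{a})|}.$$
   Context: A parking function of $[n]$ is a vector $\mathbf{a}\in\mathbb{N}^{[n]}$ such that, whenever $\sigma$ is a permutation with $a_{\sigma(1)}\le\cdots\le a_{\sigma(n)}$, one has $a_{\sigma(i)}\le i-1$ for all $i$; $\mathrm{Park}_{[n]}$ is the set of these. $\mathrm{Area}(\mathbf{a})=a_1+\dots+a_n$ and $\mathrm{supp}(\mathbf{a})=\{i:a_i>0\}$. An acyclic orientation orients every edge with no directed cycle.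
   Formalization: The edge probability p is taken to be a rational number in (0,1) rather than a real one; since both sides are polynomials in p, the identity for real p follows. -}

module Defs where

open import Data.Bool using (Bool; true; false; _∧_; _∨_; not; if_then_else_)
open import Data.Nat as ℕ using (ℕ; zero; suc; _∸_)
import Data.Nat.Properties as ℕP
open import Data.Nat.Combinatorics using (_C_)
open import Data.Fin using (Fin; toℕ)
open import Data.Fin.Properties using () renaming (_≟_ to _≟F_)
open import Data.List using (List; []; _∷_; _++_; map; concatMap; filter; length; foldr; allFin; upTo)
open import Data.Bool.ListAction using (any)
open import Data.Vec using (Vec; toList)
import Data.Vec as V
open import Data.Product using (_×_; _,_)
open import Data.Rational using (ℚ; 0ℚ; 1ℚ; _+_; _*_; _-_; 1/_; ≢-nonZero)
open import Data.Rational.Properties using (_≟_)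
open import Relation.Nullary using (yes; no; does)
import Data.List.Sort.InsertionSort as Sort

pow : ℚ → ℕ → ℚ
pow x zero    = 1ℚ
pow x (suc k) = x * pow x k

-- 1/x (only ever applied to nonzero x; returns 0 at 0 for totality)
inv : ℚ → ℚ
inv x with x ≟ 0ℚ
... | yes _  = 0ℚ
... | no x≢0 = 1/_ x {{≢-nonZero x≢0}}

fromℕℚ : ℕ → ℚ
fromℕℚ k = Data.Rational.normalize k 1
  where import Data.Rational

sumℚ : List ℚ → ℚ
sumℚ = foldr _+_ 0ℚ

pairs : (n : ℕ) → List (Fin n × Fin n)
pairs n = concatMap (λ i → concatMap (λ j → if does (toℕ i ℕ.<? toℕ j) then (i , j) ∷ [] else []) (allFin n)) (allFin n)

sublists : ∀ {A : Set} → List A → List (List A)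
sublists []       = [] ∷ []
sublists (x ∷ xs) = let r = sublists xs in r ++ map (x ∷_) r

graphs : (n : ℕ) → List (List (Fin n × Fin n))
graphs n = sublists (pairs n)

orientations : ∀ {n} → List (Fin n × Fin n) → List (List (Fin n × Fin n))
orientations []             = [] ∷ []
orientations ((i , j) ∷ es) = let r = orientations es in map ((i , j) ∷_) r ++ map ((j , i) ∷_) r

_==_ : ∀ {n} → Fin n → Fin n → Bool
a == b = does (a ≟F b)

arc : ∀ {n} → List (Fin n × Fin n) → Fin n → Fin n → Bool
arc D u v = any (λ { (a , b) → (a == u) ∧ (b == v) }) D

walk : ∀ {n} → List (Fin n × Fin n) → ℕ → Fin n → Fin n → Bool
walk {n} D zero    u v = u == v
walk {n} D (suc k) u v = any (λ w → arc D u w ∧ walk D k w v) (allFin n)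

-- D contains a directed cycle: a closed directed walk of length between
-- 1 and n (any directed cycle on n vertices has length ≤ n, and any
-- closed walk of positive length contains a directed cycle)
hasDirectedCycle : ∀ {n} → List (Fin n × Fin n) → Bool
hasDirectedCycle {n} D = any (λ v → any (λ k → walk D (suc k) v v) (upTo n)) (allFin n)

numAcyclicOrientations : ∀ {n} → List (Fin n × Fin n) → ℕ
numAcyclicOrientations G = length (filter (λ D → not (hasDirectedCycle D) Data.Bool.≟ true) (orientations G))
  where import Data.Bool

expectedAcyclicOrientations : ℕ → ℚ → ℚ
expectedAcyclicOrientations n p =
  sumℚ (map (λ G → pow p (length G) * pow (1ℚ - p) (n C 2 ∸ length G)
                     * fromℕℚ (numAcyclicOrientations G))
            (graphs n))

open Sort ℕP.≤-decTotalOrder using (sort)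

-- sorted list b_1 ≤ ... ≤ b_n satisfies b_i ≤ i - 1 (indices from 1)
boundedFrom : ℕ → List ℕ → Bool
boundedFrom i []       = true
boundedFrom i (b ∷ bs) = does (b ℕ.≤? i) ∧ boundedFrom (suc i) bs

isParking : ∀ {n} → Vec ℕ n → Bool
isParking a = boundedFrom 0 (sort (toList a))

vecsBelow : (m n : ℕ) → List (Vec ℕ n)
vecsBelow m zero    = V.[] ∷ []
vecsBelow m (suc n) = concatMap (λ x → map (x V.∷_) (vecsBelow m n)) (upTo m)

-- Park_[n]; every parking function has all entries ≤ n - 1 < n,
-- so filtering the vectors with entries < n gives exactly Park_[n]
Park : (n : ℕ) → List (Vec ℕ n)
Park n = filter (λ a → isParking a Data.Bool.≟ true) (vecsBelow n n)
  where import Data.Bool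

Area : ∀ {n} → Vec ℕ n → ℕ
Area a = V.sum a

suppSize : ∀ {n} → Vec ℕ n → ℕ
suppSize a = V.count (λ x → 0 ℕ.<? x) a

{-# OPTIONS --safe #-}
module Submission where

-- Write q = 1 - p and r = 1/q. Both sides are determined by one recursion: the sum over
-- all ways to split a nonempty vertex set V into S and R of (-1)^|S| q^(|S| choose 2) X(R)
-- is zero.
--
-- Graph side: weight every pair of vertices by q (no edge), p or p (the two directions) and
-- let X(V) be the total weight of the acyclic digraphs on V. The term of (S , R) is
-- (-1)^|S| times the weight of the acyclic digraphs on V in which all of S are sources: pairs
-- inside S contribute q, and pairs between S and R contribute q + p = 1. Summing over S
-- gives zero because an acyclic digraph on a nonempty set has a source (Robinson).
--
-- Parking side: give the value 0 weight 1 and the value j > 0 weight p r^j = r^j - r^(j-1),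
-- so that the values 0, ..., k have total weight r^k. Consider a sequence indexed by V with
-- a split (S , R) such that its restriction to S is a parking function and its entries on R
-- are at most |S|, counted with sign (-1)^|R|. Moving the position of the largest entry
-- from one part to the other reverses the sign, so the weighted numbers P(k) of parking
-- functions satisfy sum (-1)^|R| P(|S|) r^(|S||R|) = 0. This is the recursion for
-- q^(k choose 2) P(k).

open import Defs
open import Data.Bool using (Bool; true; false; _∧_; _∨_; not; if_then_else_; T)
import Data.Bool as Bool
open import Data.Bool.ListAction using (all; any)
import Data.Bool.Properties as BoolP
open import Data.Empty using (⊥-elim)
open import Data.Fin as Fin using (Fin; toℕ)
import Data.Fin.Properties as FinP
import Data.Integer as ℤ
import Data.Integer.Properties as ℤP
open import Data.List using (List; []; _∷_; _++_; map; concatMap; filter; filterᵇ; length; upTo; allFin)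
open import Data.List.Membership.Propositional using (_∈_; find; lose)
open import Data.List.Membership.Propositional.Properties using (∈-upTo⁺; ∈-upTo⁻; ∈-filter⁺; ∈-filter⁻; ∈-allFin)
import Data.List.Properties as ListP
open import Data.List.Relation.Binary.Permutation.Propositional as ↭ using (_↭_; ↭-refl; ↭-sym; ↭-trans; ↭⇒↭ₛ)
import Data.List.Relation.Binary.Permutation.Propositional.Properties as ↭P
open import Data.List.Relation.Binary.Pointwise using (Pointwise-≡⇒≡)
open import Data.List.Relation.Ternary.Interleaving.Propositional using (Interleaving; []; _∷ˡ_; _∷ʳ_; consˡ; consʳ)
open import Data.List.Relation.Unary.All as All using (All; []; _∷_)
import Data.List.Relation.Unary.All.Properties as AllP
open import Data.List.Relation.Unary.AllPairs using (AllPairs; []; _∷_)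
import Data.List.Relation.Unary.AllPairs.Properties as AllPairsP
open import Data.List.Relation.Unary.Any using (here; there)
import Data.List.Relation.Unary.Any.Properties as AnyP
open import Data.List.Relation.Unary.Unique.Propositional using (Unique)
open import Data.List.Relation.Unary.Unique.Propositional.Properties using (allFin⁺)
open import Data.Nat as ℕ using (ℕ; zero; suc; _≤_; _∸_; s≤s; z≤n)
open import Data.Nat.Combinatorics using (_C_; nC1≡n; nCk+nC[k+1]≡[n+1]C[k+1])
import Data.Nat.Properties as ℕP
import Data.Nat.Solver as ℕSolver
open import Data.List.Relation.Unary.Sorted.TotalOrder ℕP.≤-totalOrder using (Sorted)
open import Data.List.Relation.Unary.Sorted.TotalOrder.Properties using (↗↭↗⇒≋; AllPairs⇒Sorted; Sorted⇒AllPairs)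
open import Data.List.Sort.InsertionSort ℕP.≤-decTotalOrder using (sort)
open import Data.List.Sort.InsertionSort.Properties ℕP.≤-decTotalOrder using (sort-↭; sort-↗)
open import Data.Product using (∃; ∃-syntax; ∃₂; _×_; _,_; proj₁; proj₂; swap)
open import Data.Rational using (ℚ; 0ℚ; 1ℚ; _<_; _+_; _*_; _-_; -_)
import Data.Rational as ℚ
import Data.Rational.Properties as ℚP
open import Data.Rational.Solver using (module +-*-Solver)
import Data.Rational.Unnormalised as ℚᵘ
import Data.Rational.Unnormalised.Properties as ℚᵘP
open import Data.Sum using (inj₁; inj₂)
open import Data.Unit using (tt)
open import Data.Vec as Vec using (Vec; toList)
open import Function using (_∘_; id)
open import Function.Bundles using (Equivalence)
open import Relation.Binary.PropositionalEquality using (_≡_; _≢_; refl; sym; trans; cong; cong₂; subst; module ≡-Reasoning)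
open import Relation.Nullary using (¬_; Dec; yes; no; does; contradiction)
open import Relation.Nullary.Decidable using (T?; dec-true; dec-false)
open ≡-Reasoning

private variable
  A B : Set

-- Finite sums

∑ : List A → (A → ℚ) → ℚ
∑ xs f = sumℚ (map f xs)

-- Holds of `∑ xs` and of `orientSum es`, so that `∑-interchange` covers exchanging two sums as well
-- as moving a sum past a weighted sum over orientations. `L-cong` does the work of function
-- extensionality.
record Linear (L : (A → ℚ) → ℚ) : Set where
  field
    L-cong : ∀ {f g} → (∀ x → f x ≡ g x) → L f ≡ L g
    L-+    : ∀ f g → L (λ x → f x + g x) ≡ L f + L g
    L-*    : ∀ c f → L (λ x → c * f x) ≡ c * L f

  L-0 : L (λ _ → 0ℚ) ≡ 0ℚ
  L-0 = trans (L-* 0ℚ (λ _ → 0ℚ)) (ℚP.*-zeroˡ (L (λ _ → 0ℚ)))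

open Linear

∑-linear : (xs : List A) → Linear (∑ xs)
∑-linear []       = record
  { L-cong = λ _ → refl
  ; L-+    = λ _ _ → refl
  ; L-*    = λ c _ → sym (ℚP.*-zeroʳ c)
  }
∑-linear (x ∷ xs) = record
  { L-cong = λ eq → cong₂ _+_ (eq x) (L-cong (∑-linear xs) eq)
  ; L-+    = λ f g → trans (cong (f x + g x +_) (L-+ (∑-linear xs) f g))
      (solve 4 (λ a b c d → (a :+ b) :+ (c :+ d) := (a :+ c) :+ (b :+ d)) refl (f x) (g x) (∑ xs f) (∑ xs g))
  ; L-*    = λ c f → trans (cong (c * f x +_) (L-* (∑-linear xs) c f)) (sym (ℚP.*-distribˡ-+ c (f x) (∑ xs f)))
  }
  where open +-*-Solver

∑-cong : (xs : List A) {f g : A → ℚ} → (∀ x → f x ≡ g x) → ∑ xs f ≡ ∑ xs g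
∑-cong xs = L-cong (∑-linear xs)

∑-cong-All : {P : A → Set} {xs : List A} {f g : A → ℚ} →
  All P xs → (∀ {x} → P x → f x ≡ g x) → ∑ xs f ≡ ∑ xs g
∑-cong-All []         eq = refl
∑-cong-All (px ∷ pxs) eq = cong₂ _+_ (eq px) (∑-cong-All pxs eq)

∑-interchange : {L : (A → ℚ) → ℚ} → Linear L → (ys : List B) (f : A → B → ℚ) →
  L (λ x → ∑ ys (f x)) ≡ ∑ ys (λ y → L (λ x → f x y))
∑-interchange lin []       f = L-0 lin
∑-interchange {L = L} lin (y ∷ ys) f = trans (L-+ lin (λ x → f x y) (λ x → ∑ ys (f x))) (cong (L (λ x → f x y) +_) (∑-interchange lin ys f))

∑-++ : (xs ys : List A) (f : A → ℚ) → ∑ (xs ++ ys) f ≡ ∑ xs f + ∑ ys f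
∑-++ []       ys f = sym (ℚP.+-identityˡ _)
∑-++ (x ∷ xs) ys f = trans (cong (f x +_) (∑-++ xs ys f)) (sym (ℚP.+-assoc (f x) _ _))

∑-map : (h : A → B) (xs : List A) (f : B → ℚ) → ∑ (map h xs) f ≡ ∑ xs (f ∘ h)
∑-map h xs f = cong sumℚ (sym (ListP.map-∘ xs))

∑-concatMap : (h : A → List B) (xs : List A) (f : B → ℚ) →
  ∑ (concatMap h xs) f ≡ ∑ xs (λ x → ∑ (h x) f)
∑-concatMap h []       f = refl
∑-concatMap h (x ∷ xs) f = trans (∑-++ (h x) _ f) (cong (∑ (h x) f +_) (∑-concatMap h xs f))

-- Indicators, powers and binomial coefficients

⟦_⟧ : Bool → ℚ
⟦ true  ⟧ = 1ℚ
⟦ false ⟧ = 0ℚ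

⟦∧⟧ : ∀ a b → ⟦ a ∧ b ⟧ ≡ ⟦ a ⟧ * ⟦ b ⟧
⟦∧⟧ true  b = sym (ℚP.*-identityˡ _)
⟦∧⟧ false b = sym (ℚP.*-zeroˡ ⟦ b ⟧)

∑-filter : (b : A → Bool) (xs : List A) (f : A → ℚ) →
  ∑ (filter (λ x → b x Bool.≟ true) xs) f ≡ ∑ xs (λ x → ⟦ b x ⟧ * f x)
∑-filter b []       f = refl
∑-filter b (x ∷ xs) f with b x
... | true  = cong₂ _+_ (sym (ℚP.*-identityˡ (f x))) (∑-filter b xs f)
... | false = trans (∑-filter b xs f)
                (trans (sym (ℚP.+-identityˡ _)) (cong (_+ _) (sym (ℚP.*-zeroˡ (f x)))))

-- `fromℕℚ` normalises a fraction and does not reduce at a variable `k`. On unnormalised fractions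
-- the claim becomes an equation between integers.
fromℕℚ-suc : ∀ k → fromℕℚ (suc k) ≡ 1ℚ + fromℕℚ k
fromℕℚ-suc k = ℚP.toℚᵘ-injective
  (ℚᵘP.≃-trans (ℚP.toℚᵘ-fromℚᵘ (ℚᵘ.mkℚᵘ (ℤ.+ suc k) 0))
  (ℚᵘP.≃-trans (ℚᵘ.*≡* (cong (λ i → (ℤ.+ 1 ℤ.+ i) ℤ.* ℤ.+ 1) (sym (ℤP.*-identityʳ (ℤ.+ k)))))
  (ℚᵘP.≃-trans (ℚᵘP.+-congʳ ℚᵘ.1ℚᵘ (ℚᵘP.≃-sym (ℚP.toℚᵘ-fromℚᵘ (ℚᵘ.mkℚᵘ (ℤ.+ k) 0))))
  (ℚᵘP.≃-sym (ℚP.toℚᵘ-homo-+ 1ℚ (fromℕℚ k))))))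

fromℕℚ-length : (xs : List A) → fromℕℚ (length xs) ≡ ∑ xs (λ _ → 1ℚ)
fromℕℚ-length []       = refl
fromℕℚ-length (x ∷ xs) = trans (fromℕℚ-suc (length xs)) (cong (1ℚ +_) (fromℕℚ-length xs))

pow-+ : ∀ x m n → pow x (m ℕ.+ n) ≡ pow x m * pow x n
pow-+ x zero    n = sym (ℚP.*-identityˡ _)
pow-+ x (suc m) n = trans (cong (x *_) (pow-+ x m n)) (sym (ℚP.*-assoc x _ _))

pow-* : ∀ x m n → pow (pow x m) n ≡ pow x (m ℕ.* n)
pow-* x m zero    = sym (cong (pow x) (ℕP.*-zeroʳ m))
pow-* x m (suc n) = begin
  pow x m * pow (pow x m) n    ≡⟨ cong (pow x m *_) (pow-* x m n) ⟩
  pow x m * pow x (m ℕ.* n)    ≡⟨ pow-+ x m (m ℕ.* n) ⟨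
  pow x (m ℕ.+ m ℕ.* n)        ≡⟨ cong (pow x) (ℕP.*-suc m n) ⟨
  pow x (m ℕ.* suc n)          ∎

pow-inverse : ∀ {x y} → x * y ≡ 1ℚ → ∀ n → pow x n * pow y n ≡ 1ℚ
pow-inverse         xy≡1 zero    = refl
pow-inverse {x} {y} xy≡1 (suc n) = begin
  (x * pow x n) * (y * pow y n)  ≡⟨ solve 4 (λ a b c d → (a :* b) :* (c :* d) := (a :* c) :* (b :* d)) refl x (pow x n) y (pow y n) ⟩
  (x * y) * (pow x n * pow y n)  ≡⟨ cong₂ _*_ xy≡1 (pow-inverse xy≡1 n) ⟩
  1ℚ ∎
  where open +-*-Solver

[1+n]C2 : ∀ n → suc n C 2 ≡ n ℕ.+ n C 2
[1+n]C2 n = trans (sym (nCk+nC[k+1]≡[n+1]C[k+1] n 1)) (cong (ℕ._+ n C 2) (nC1≡n n))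

-- A pair in a disjoint union lies inside one of the two parts or crosses between them; the crossing
-- pairs give `m * n`.
[m+n]C2 : ∀ m n → (m ℕ.+ n) C 2 ≡ m C 2 ℕ.+ n C 2 ℕ.+ m ℕ.* n
[m+n]C2 zero    n = sym (ℕP.+-identityʳ _)
[m+n]C2 (suc m) n = begin
  suc (m ℕ.+ n) C 2                                  ≡⟨ [1+n]C2 (m ℕ.+ n) ⟩
  m ℕ.+ n ℕ.+ (m ℕ.+ n) C 2                          ≡⟨ cong (m ℕ.+ n ℕ.+_) ([m+n]C2 m n) ⟩
  m ℕ.+ n ℕ.+ (m C 2 ℕ.+ n C 2 ℕ.+ m ℕ.* n)          ≡⟨ solve 5 (λ m n a b c → m :+ n :+ (a :+ b :+ c) := (m :+ a) :+ b :+ (n :+ c)) refl m n (m C 2) (n C 2) (m ℕ.* n) ⟩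
  (m ℕ.+ m C 2) ℕ.+ n C 2 ℕ.+ (n ℕ.+ m ℕ.* n)        ≡⟨ cong (λ k → k ℕ.+ n C 2 ℕ.+ (n ℕ.+ m ℕ.* n)) ([1+n]C2 m) ⟨
  suc m C 2 ℕ.+ n C 2 ℕ.+ (n ℕ.+ m ℕ.* n)            ∎
  where open ℕSolver.+-*-Solver

-- Splittings of a list into two complementary subsequences

splits : List A → List (List A × List A)
splits []       = ([] , []) ∷ []
splits (x ∷ xs) = map (λ (S , R) → x ∷ S , R) (splits xs) ++ map (λ (S , R) → S , x ∷ R) (splits xs)

∑-splits-∷ : (x : A) (xs : List A) (f : List A × List A → ℚ) →
  ∑ (splits (x ∷ xs)) f ≡ ∑ (splits xs) (λ (S , R) → f (x ∷ S , R)) + ∑ (splits xs) (λ (S , R) → f (S , x ∷ R))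
∑-splits-∷ x xs f = trans (∑-++ (map _ (splits xs)) _ f) (cong₂ _+_ (∑-map _ (splits xs) f) (∑-map _ (splits xs) f))

splits-interleaving : (xs : List A) → All (λ (S , R) → Interleaving S R xs) (splits xs)
splits-interleaving []       = [] ∷ []
splits-interleaving (x ∷ xs) = AllP.++⁺
  (AllP.map⁺ (All.map consˡ (splits-interleaving xs)))
  (AllP.map⁺ (All.map consʳ (splits-interleaving xs)))

∑-splits-cong : (xs : List A) {f g : List A × List A → ℚ} →
  (∀ {S R} → Interleaving S R xs → f (S , R) ≡ g (S , R)) → ∑ (splits xs) f ≡ ∑ (splits xs) g
∑-splits-cong xs eq = ∑-cong-All (splits-interleaving xs) eq

∑-splits-swap : (xs : List A) (f : List A × List A → ℚ) → ∑ (splits xs) f ≡ ∑ (splits xs) (f ∘ swap)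
∑-splits-swap []       f = refl
∑-splits-swap (x ∷ xs) f = begin
  ∑ (splits (x ∷ xs)) f
    ≡⟨ ∑-splits-∷ x xs f ⟩
  ∑ (splits xs) (λ (S , R) → f (x ∷ S , R)) + ∑ (splits xs) (λ (S , R) → f (S , x ∷ R))
    ≡⟨ cong₂ _+_ (∑-splits-swap xs _) (∑-splits-swap xs _) ⟩
  ∑ (splits xs) (λ (S , R) → f (x ∷ R , S)) + ∑ (splits xs) (λ (S , R) → f (R , x ∷ S))
    ≡⟨ ℚP.+-comm (∑ (splits xs) (λ (S , R) → f (x ∷ R , S))) _ ⟩
  ∑ (splits xs) (λ (S , R) → f (R , x ∷ S)) + ∑ (splits xs) (λ (S , R) → f (x ∷ R , S))
    ≡⟨ ∑-splits-∷ x xs (f ∘ swap) ⟨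
  ∑ (splits (x ∷ xs)) (f ∘ swap) ∎

interleaving-length : {S R xs : List A} → Interleaving S R xs → length xs ≡ length S ℕ.+ length R
interleaving-length []             = refl
interleaving-length (refl ∷ˡ sp)   = cong suc (interleaving-length sp)
interleaving-length {S = S} {R = _ ∷ R} (refl ∷ʳ sp) = trans (cong suc (interleaving-length sp)) (sym (ℕP.+-suc (length S) (length R)))

-- Only the split `([] , xs)` has a second part as long as `xs`. This isolates the leading term of a
-- recursion whose other terms are known by induction on length.
∑-splits-leading : (xs : List A) (f : List A × List A → ℚ) →
  (∀ {S R} → Interleaving S R xs → length R ℕ.< length xs → f (S , R) ≡ 0ℚ) →
  ∑ (splits xs) f ≡ f ([] , xs)
∑-splits-leading []       f _    = ℚP.+-identityʳ _
∑-splits-leading (x ∷ xs) f vanish = begin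
  ∑ (splits (x ∷ xs)) f
    ≡⟨ ∑-splits-∷ x xs f ⟩
  ∑ (splits xs) (λ (S , R) → f (x ∷ S , R)) + ∑ (splits xs) (λ (S , R) → f (S , x ∷ R))
    ≡⟨ cong₂ _+_
         (trans (∑-splits-cong xs (λ {S} {R} sp → vanish (consˡ sp) (s≤s (subst (length R ≤_) (sym (interleaving-length sp)) (ℕP.m≤n+m _ _)))))
                (L-0 (∑-linear (splits xs))))
         (∑-splits-leading xs _ (λ sp lt → vanish (consʳ sp) (s≤s lt))) ⟩
  0ℚ + f ([] , x ∷ xs)
    ≡⟨ ℚP.+-identityˡ _ ⟩
  f ([] , x ∷ xs) ∎

-- Parking functions

park : List ℕ → Bool
park xs = boundedFrom 0 (sort xs)

-- Two sorted lists that are permutations of each other coincide. Hence `sort` can be evaluated by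
-- exhibiting any sorted rearrangement, without following the algorithm.
sort-unique : ∀ {xs ys} → Sorted ys → xs ↭ ys → sort xs ≡ ys
sort-unique {xs} ys↗ xs↭ys =
  Pointwise-≡⇒≡ (↗↭↗⇒≋ ℕP.≤-totalOrder (sort-↗ xs) ys↗ (↭⇒↭ₛ (↭-trans (sort-↭ xs) xs↭ys)))

park-↭ : ∀ {xs ys} → xs ↭ ys → park xs ≡ park ys
park-↭ {ys = ys} xs↭ys = cong (boundedFrom 0) (sort-unique (sort-↗ ys) (↭-trans xs↭ys (↭-sym (sort-↭ ys))))

sort-max-∷ : ∀ {m xs} → All (_≤ m) xs → sort (m ∷ xs) ≡ sort xs ++ m ∷ []
sort-max-∷ {m} {xs} xs≤m = sort-unique
  (AllPairs⇒Sorted ℕP.≤-totalOrder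
    (AllPairsP.++⁺ (Sorted⇒AllPairs ℕP.≤-totalOrder (sort-↗ xs)) ([] ∷ [])
      (All.map (_∷ []) (↭P.All-resp-↭ (↭-sym (sort-↭ xs)) xs≤m))))
  (↭-trans (↭.prep m (↭-sym (sort-↭ xs))) (↭P.∷↭∷ʳ m (sort xs)))

boundedFrom-∷ʳ : ∀ i xs m → boundedFrom i (xs ++ m ∷ []) ≡ boundedFrom i xs ∧ does (m ℕ.≤? i ℕ.+ length xs)
boundedFrom-∷ʳ i []       m = trans (BoolP.∧-identityʳ _) (cong (λ k → does (m ℕ.≤? k)) (sym (ℕP.+-identityʳ i)))
boundedFrom-∷ʳ i (x ∷ xs) m = begin
  does (x ℕ.≤? i) ∧ boundedFrom (suc i) (xs ++ m ∷ [])
    ≡⟨ cong (does (x ℕ.≤? i) ∧_) (boundedFrom-∷ʳ (suc i) xs m) ⟩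
  does (x ℕ.≤? i) ∧ (boundedFrom (suc i) xs ∧ does (m ℕ.≤? suc i ℕ.+ length xs))
    ≡⟨ BoolP.∧-assoc (does (x ℕ.≤? i)) _ _ ⟨
  (does (x ℕ.≤? i) ∧ boundedFrom (suc i) xs) ∧ does (m ℕ.≤? suc i ℕ.+ length xs)
    ≡⟨ cong (λ k → (does (x ℕ.≤? i) ∧ boundedFrom (suc i) xs) ∧ does (m ℕ.≤? k)) (ℕP.+-suc i (length xs)) ⟨
  (does (x ℕ.≤? i) ∧ boundedFrom (suc i) xs) ∧ does (m ℕ.≤? i ℕ.+ suc (length xs)) ∎

-- A largest entry can be placed last in sorted order, where it leaves the conditions on the other
-- entries unchanged and is itself bounded by their number.
park-max-∷ : ∀ {m xs} → All (_≤ m) xs → park (m ∷ xs) ≡ park xs ∧ does (m ℕ.≤? length xs)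
park-max-∷ {m} {xs} xs≤m = begin
  boundedFrom 0 (sort (m ∷ xs))                      ≡⟨ cong (boundedFrom 0) (sort-max-∷ xs≤m) ⟩
  boundedFrom 0 (sort xs ++ m ∷ [])                  ≡⟨ boundedFrom-∷ʳ 0 (sort xs) m ⟩
  park xs ∧ does (m ℕ.≤? length (sort xs))           ≡⟨ cong (λ k → park xs ∧ does (m ℕ.≤? k)) (↭P.↭-length (sort-↭ xs)) ⟩
  park xs ∧ does (m ℕ.≤? length xs)                  ∎

allBelow : ℕ → List ℕ → Bool
allBelow k = all (λ x → does (x ℕ.≤? k))

allBelow-↭ : ∀ k {xs ys} → xs ↭ ys → allBelow k xs ≡ allBelow k ys
allBelow-↭ k ↭.refl = refl
allBelow-↭ k (↭.prep x p) = cong (does (x ℕ.≤? k) ∧_) (allBelow-↭ k p)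
allBelow-↭ k (↭.swap {ys = ys} x y p) = trans (cong (λ b → does (x ℕ.≤? k) ∧ (does (y ℕ.≤? k) ∧ b)) (allBelow-↭ k p))
  (x∧yz≡y∧xz (does (x ℕ.≤? k)) (does (y ℕ.≤? k)) (allBelow k ys))
  where
  x∧yz≡y∧xz : ∀ a b c → a ∧ (b ∧ c) ≡ b ∧ (a ∧ c)
  x∧yz≡y∧xz a b c = trans (sym (BoolP.∧-assoc a b c)) (trans (cong (_∧ c) (BoolP.∧-comm a b)) (BoolP.∧-assoc b a c))
allBelow-↭ k (↭.trans p q) = trans (allBelow-↭ k p) (allBelow-↭ k q)

allBelow-true : ∀ {k xs} → All (_≤ k) xs → allBelow k xs ≡ true
allBelow-true []           = refl
allBelow-true {k} {x ∷ xs} (x≤k ∷ xs≤k) = cong₂ _∧_ (dec-true (x ℕ.≤? k) x≤k) (allBelow-true xs≤k)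

-- Permuting a list permutes the parts of its splits, which `f` does not notice. This lets the
-- largest entry be brought to the front before it is toggled.
∑-splits-↭ : (f : List A × List A → ℚ) →
  (∀ {S S′ R R′} → S ↭ S′ → R ↭ R′ → f (S , R) ≡ f (S′ , R′)) →
  ∀ {xs ys} → xs ↭ ys → ∑ (splits xs) f ≡ ∑ (splits ys) f
∑-splits-↭ f resp ↭.refl = refl
∑-splits-↭ f resp (↭.prep {xs} {ys} x p) = begin
  ∑ (splits (x ∷ xs)) f
    ≡⟨ ∑-splits-∷ x xs f ⟩
  ∑ (splits xs) (λ (S , R) → f (x ∷ S , R)) + ∑ (splits xs) (λ (S , R) → f (S , x ∷ R))
    ≡⟨ cong₂ _+_ (∑-splits-↭ _ (λ s r → resp (↭.prep x s) r) p) (∑-splits-↭ _ (λ s r → resp s (↭.prep x r)) p) ⟩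
  ∑ (splits ys) (λ (S , R) → f (x ∷ S , R)) + ∑ (splits ys) (λ (S , R) → f (S , x ∷ R))
    ≡⟨ ∑-splits-∷ x ys f ⟨
  ∑ (splits (x ∷ ys)) f ∎
∑-splits-↭ f resp (↭.swap {xs} {ys} x y p) = begin
  ∑ (splits (x ∷ y ∷ xs)) f
    ≡⟨ unfold x y xs ⟩
  (∑ (splits xs) (λ (S , R) → f (x ∷ y ∷ S , R)) + ∑ (splits xs) (λ (S , R) → f (x ∷ S , y ∷ R))) +
  (∑ (splits xs) (λ (S , R) → f (y ∷ S , x ∷ R)) + ∑ (splits xs) (λ (S , R) → f (S , x ∷ y ∷ R)))
    ≡⟨ cong₂ _+_
        (cong₂ _+_ (trans (∑-cong (splits xs) (λ _ → resp (↭.swap x y ↭-refl) ↭-refl)) (∑-splits-↭ _ (λ s r → resp (↭.prep y (↭.prep x s)) r) p))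
                   (∑-splits-↭ _ (λ s r → resp (↭.prep x s) (↭.prep y r)) p))
        (cong₂ _+_ (∑-splits-↭ _ (λ s r → resp (↭.prep y s) (↭.prep x r)) p)
                   (trans (∑-cong (splits xs) (λ _ → resp ↭-refl (↭.swap x y ↭-refl))) (∑-splits-↭ _ (λ s r → resp s (↭.prep y (↭.prep x r))) p))) ⟩
  (∑ (splits ys) (λ (S , R) → f (y ∷ x ∷ S , R)) + ∑ (splits ys) (λ (S , R) → f (x ∷ S , y ∷ R))) +
  (∑ (splits ys) (λ (S , R) → f (y ∷ S , x ∷ R)) + ∑ (splits ys) (λ (S , R) → f (S , y ∷ x ∷ R)))
    -- The two middle terms, with `x` and `y` in different parts, come in the opposite order when
    -- `y` is listed first.
    ≡⟨ solve 4 (λ a b c d → (a :+ b) :+ (c :+ d) := (a :+ c) :+ (b :+ d)) refl (∑ (splits ys) (λ (S , R) → f (y ∷ x ∷ S , R))) _ _ _ ⟩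
  (∑ (splits ys) (λ (S , R) → f (y ∷ x ∷ S , R)) + ∑ (splits ys) (λ (S , R) → f (y ∷ S , x ∷ R))) +
  (∑ (splits ys) (λ (S , R) → f (x ∷ S , y ∷ R)) + ∑ (splits ys) (λ (S , R) → f (S , y ∷ x ∷ R)))
    ≡⟨ unfold y x ys ⟨
  ∑ (splits (y ∷ x ∷ ys)) f ∎
  where
  open +-*-Solver using (solve; _:=_; _:+_; _:*_; con)
  unfold : ∀ x y xs → ∑ (splits (x ∷ y ∷ xs)) f ≡
    (∑ (splits xs) (λ (S , R) → f (x ∷ y ∷ S , R)) + ∑ (splits xs) (λ (S , R) → f (x ∷ S , y ∷ R))) +
    (∑ (splits xs) (λ (S , R) → f (y ∷ S , x ∷ R)) + ∑ (splits xs) (λ (S , R) → f (S , x ∷ y ∷ R)))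
  unfold x y xs = trans (∑-splits-∷ x (y ∷ xs) f) (cong₂ _+_ (∑-splits-∷ y xs _) (∑-splits-∷ y xs _))
∑-splits-↭ f resp (↭.trans p q) = trans (∑-splits-↭ f resp p) (∑-splits-↭ f resp q)

extractMax : ∀ x xs → ∃₂ λ m ys → (x ∷ xs ↭ m ∷ ys) × All (_≤ m) ys
extractMax x []       = x , [] , ↭-refl , []
extractMax x (y ∷ xs) with extractMax y xs
... | m , ys , p , ys≤m with ℕP.≤-total x m
... | inj₁ x≤m = m , x ∷ ys , ↭-trans (↭.prep x p) (↭.swap x m ↭-refl) , x≤m ∷ ys≤m
... | inj₂ m≤x = x , m ∷ ys , ↭.prep x p , m≤x ∷ All.map (λ y≤m → ℕP.≤-trans y≤m m≤x) ys≤m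

signedPark : List ℕ × List ℕ → ℚ
signedPark (S , R) = pow (- 1ℚ) (length R) * ⟦ park S ∧ allBelow (length S) R ⟧

signedPark-↭ : ∀ {S S′ R R′} → S ↭ S′ → R ↭ R′ → signedPark (S , R) ≡ signedPark (S′ , R′)
signedPark-↭ {S′ = S′} {R = R} s r
  rewrite ↭P.↭-length r | park-↭ s | ↭P.↭-length s | allBelow-↭ (length S′) r = refl

interleaving-All : {P : A → Set} {S R xs : List A} → Interleaving S R xs → All P xs → All P S × All P R
interleaving-All []         []         = [] , []
interleaving-All (consˡ sp) (px ∷ pxs) = let pS , pR = interleaving-All sp pxs in px ∷ pS , pR
interleaving-All (consʳ sp) (px ∷ pxs) = let pS , pR = interleaving-All sp pxs in pS , px ∷ pR

-- By `park-max-∷`, an `m` added to `S` must satisfy `m ≤ length S`, which is also the condition on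
-- an `m` placed in `R`. Adding `m` to `S` raises the bound on the rest of `R` by one, but those
-- entries are at most `m` and so satisfy both bounds. The two indicators agree and the signs are
-- opposite.
signedPark-toggle : ∀ {m S R} → All (_≤ m) S → All (_≤ m) R → signedPark (m ∷ S , R) + signedPark (S , m ∷ R) ≡ 0ℚ
signedPark-toggle {m} {S} {R} S≤m R≤m = begin
  s * ⟦ park (m ∷ S) ∧ allBelow (suc (length S)) R ⟧ + (- 1ℚ * s) * ⟦ park S ∧ (does (m ℕ.≤? length S) ∧ allBelow (length S) R) ⟧
    ≡⟨ cong (λ b → s * ⟦ b ⟧ + (- 1ℚ * s) * ⟦ park S ∧ (does (m ℕ.≤? length S) ∧ allBelow (length S) R) ⟧) same ⟩
  s * x + (- 1ℚ * s) * x
    ≡⟨ solve 2 (λ s x → s :* x :+ (con (- 1ℚ) :* s) :* x := con 0ℚ) refl s x ⟩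
  0ℚ ∎
  where
  open +-*-Solver using (solve; _:=_; _:+_; _:*_; con)
  s x : ℚ
  s = pow (- 1ℚ) (length R)
  x = ⟦ park S ∧ (does (m ℕ.≤? length S) ∧ allBelow (length S) R) ⟧
  tails : does (m ℕ.≤? length S) ∧ allBelow (suc (length S)) R ≡ does (m ℕ.≤? length S) ∧ allBelow (length S) R
  tails with m ℕ.≤? length S
  ... | no  m≰|S| rewrite dec-false (m ℕ.≤? length S) m≰|S| = refl
  ... | yes m≤|S| = cong (does (m ℕ.≤? length S) ∧_)
    (trans (allBelow-true (All.map (λ r≤m → ℕP.m≤n⇒m≤1+n (ℕP.≤-trans r≤m m≤|S|)) R≤m))
           (sym (allBelow-true (All.map (λ r≤m → ℕP.≤-trans r≤m m≤|S|) R≤m))))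
  same : park (m ∷ S) ∧ allBelow (suc (length S)) R ≡ park S ∧ (does (m ℕ.≤? length S) ∧ allBelow (length S) R)
  same = trans (cong (_∧ _) (park-max-∷ S≤m)) (trans (BoolP.∧-assoc (park S) _ _) (cong (park S ∧_) tails))

-- Moving the largest entry from one part to the other is a sign-reversing involution.
∑-signedPark : ∀ x xs → ∑ (splits (x ∷ xs)) signedPark ≡ 0ℚ
∑-signedPark x xs with extractMax x xs
... | m , ys , p , ys≤m = begin
  ∑ (splits (x ∷ xs)) signedPark
    ≡⟨ ∑-splits-↭ signedPark signedPark-↭ p ⟩
  ∑ (splits (m ∷ ys)) signedPark
    ≡⟨ ∑-splits-∷ m ys signedPark ⟩
  ∑ (splits ys) (λ (S , R) → signedPark (m ∷ S , R)) + ∑ (splits ys) (λ (S , R) → signedPark (S , m ∷ R))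
    ≡⟨ L-+ (∑-linear (splits ys)) _ _ ⟨
  ∑ (splits ys) (λ (S , R) → signedPark (m ∷ S , R) + signedPark (S , m ∷ R))
    ≡⟨ ∑-splits-cong ys (λ sp → let S≤m , R≤m = interleaving-All sp ys≤m in signedPark-toggle S≤m R≤m) ⟩
  ∑ (splits ys) (λ _ → 0ℚ)
    ≡⟨ L-0 (∑-linear (splits ys)) ⟩
  0ℚ ∎

-- Bounded sequences and their splittings

seqs : ℕ → ℕ → List (List ℕ)
seqs N zero    = [] ∷ []
seqs N (suc n) = concatMap (λ x → map (x ∷_) (seqs N n)) (upTo N)

∑-seqs-suc : ∀ N n (f : List ℕ → ℚ) → ∑ (seqs N (suc n)) f ≡ ∑ (upTo N) (λ x → ∑ (seqs N n) (λ a → f (x ∷ a)))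
∑-seqs-suc N n f = trans (∑-concatMap _ (upTo N) f) (∑-cong (upTo N) (λ x → ∑-map (x ∷_) (seqs N n) f))

seqs-length : ∀ N n → All (λ a → length a ≡ n) (seqs N n)
seqs-length N zero    = refl ∷ []
seqs-length N (suc n) = AllP.concat⁺ (AllP.map⁺ (All.universal (λ x → AllP.map⁺ (All.map (cong suc) (seqs-length N n))) (upTo N)))

-- Passes from vectors to lists, so that the parts of a split sequence need no lengths in their
-- types.
∑-vecsBelow : ∀ N n (f : List ℕ → ℚ) → ∑ (vecsBelow N n) (f ∘ toList) ≡ ∑ (seqs N n) f
∑-vecsBelow N zero    f = refl
∑-vecsBelow N (suc n) f = begin
  ∑ (vecsBelow N (suc n)) (f ∘ toList)
    ≡⟨ ∑-concatMap _ (upTo N) (f ∘ toList) ⟩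
  ∑ (upTo N) (λ x → ∑ (map (x Vec.∷_) (vecsBelow N n)) (f ∘ toList))
    ≡⟨ ∑-cong (upTo N) (λ x → trans (∑-map (x Vec.∷_) (vecsBelow N n) (f ∘ toList)) (∑-vecsBelow N n (f ∘ (x ∷_)))) ⟩
  ∑ (upTo N) (λ x → ∑ (seqs N n) (λ a → f (x ∷ a)))
    ≡⟨ ∑-seqs-suc N n f ⟨
  ∑ (seqs N (suc n)) f ∎

-- Choosing a sequence indexed by `vs` and then splitting it amounts to splitting the index list
-- first and choosing a sequence on each part. The elements of `vs` serve only as positions.
∑-seqs-splits : ∀ N (vs : List A) (h : List ℕ × List ℕ → ℚ) →
  ∑ (seqs N (length vs)) (λ a → ∑ (splits a) h) ≡
  ∑ (splits vs) (λ (S , R) → ∑ (seqs N (length S)) (λ s → ∑ (seqs N (length R)) (λ r → h (s , r))))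
∑-seqs-splits N []       h = sym (ℚP.+-identityʳ (h ([] , []) + 0ℚ + 0ℚ))
∑-seqs-splits N (v ∷ vs) h = begin
  ∑ (seqs N (suc n)) (λ a → ∑ (splits a) h)
    ≡⟨ ∑-seqs-suc N n _ ⟩
  ∑ (upTo N) (λ x → ∑ (seqs N n) (λ a → ∑ (splits (x ∷ a)) h))
    ≡⟨ ∑-cong (upTo N) (λ x → trans (∑-cong (seqs N n) (λ a → ∑-splits-∷ x a h)) (L-+ (∑-linear (seqs N n)) _ _)) ⟩
  ∑ (upTo N) (λ x → ∑ (seqs N n) (λ a → ∑ (splits a) (hˡ x)) + ∑ (seqs N n) (λ a → ∑ (splits a) (hʳ x)))
    ≡⟨ ∑-cong (upTo N) (λ x → cong₂ _+_ (∑-seqs-splits N vs (hˡ x)) (∑-seqs-splits N vs (hʳ x))) ⟩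
  ∑ (upTo N) (λ x → ∑ (splits vs) (λ (S , R) → ∑ (seqs N (length S)) (λ s → ∑ (seqs N (length R)) (λ r → hˡ x (s , r))))
                  + ∑ (splits vs) (λ (S , R) → ∑ (seqs N (length S)) (λ s → ∑ (seqs N (length R)) (λ r → hʳ x (s , r)))))
    ≡⟨ L-+ (∑-linear (upTo N)) _ _ ⟩
  ∑ (upTo N) (λ x → ∑ (splits vs) (λ (S , R) → ∑ (seqs N (length S)) (λ s → ∑ (seqs N (length R)) (λ r → hˡ x (s , r))))) +
  ∑ (upTo N) (λ x → ∑ (splits vs) (λ (S , R) → ∑ (seqs N (length S)) (λ s → ∑ (seqs N (length R)) (λ r → hʳ x (s , r)))))
    ≡⟨ cong₂ _+_ (∑-interchange (∑-linear (upTo N)) (splits vs) _) (∑-interchange (∑-linear (upTo N)) (splits vs) _) ⟩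
  ∑ (splits vs) (λ (S , R) → ∑ (upTo N) (λ x → ∑ (seqs N (length S)) (λ s → ∑ (seqs N (length R)) (λ r → hˡ x (s , r))))) +
  ∑ (splits vs) (λ (S , R) → ∑ (upTo N) (λ x → ∑ (seqs N (length S)) (λ s → ∑ (seqs N (length R)) (λ r → hʳ x (s , r)))))
    ≡⟨ cong₂ _+_ (∑-cong (splits vs) (λ (S , R) → ∑-seqs-suc N (length S) _))
                 (∑-cong (splits vs) (λ (S , R) → trans (∑-cong (seqs N (length S)) (λ s → ∑-seqs-suc N (length R) _))
                                                        (sym (∑-interchange (∑-linear (upTo N)) (seqs N (length S)) _)))) ⟨
  ∑ (splits vs) (λ (S , R) → ∑ (seqs N (suc (length S))) (λ s → ∑ (seqs N (length R)) (λ r → h (s , r)))) +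
  ∑ (splits vs) (λ (S , R) → ∑ (seqs N (length S)) (λ s → ∑ (seqs N (suc (length R))) (λ r → h (s , r))))
    ≡⟨ ∑-splits-∷ v vs _ ⟨
  ∑ (splits (v ∷ vs)) (λ (S , R) → ∑ (seqs N (length S)) (λ s → ∑ (seqs N (length R)) (λ r → h (s , r)))) ∎
  where
  n : ℕ
  n = length vs
  hˡ hʳ : ℕ → List ℕ × List ℕ → ℚ
  hˡ x (S , R) = h (x ∷ S , R)
  hʳ x (S , R) = h (S , x ∷ R)

upTo-suc : ∀ N → upTo (suc N) ≡ 0 ∷ map suc (upTo N)
upTo-suc N = cong (0 ∷_) (sym (ListP.map-upTo suc N))

suc≤?suc : ∀ x k → does (suc x ℕ.≤? suc k) ≡ does (x ℕ.≤? k)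
suc≤?suc zero    k = refl
suc≤?suc (suc x) k = refl

∑-upTo-truncate : ∀ {k N} → k ℕ.< N → (f : ℕ → ℚ) →
  ∑ (upTo N) (λ x → ⟦ does (x ℕ.≤? k) ⟧ * f x) ≡ ∑ (upTo (suc k)) f
∑-upTo-truncate {zero} {suc N} (s≤s _) f = begin
  ∑ (upTo (suc N)) g                  ≡⟨ cong (λ l → ∑ l g) (upTo-suc N) ⟩
  g 0 + ∑ (map suc (upTo N)) g        ≡⟨ cong (g 0 +_) (∑-map suc (upTo N) g) ⟩
  g 0 + ∑ (upTo N) (λ x → 0ℚ * f (suc x))
                                      ≡⟨ cong (g 0 +_) (∑-cong (upTo N) (λ x → ℚP.*-zeroˡ (f (suc x)))) ⟩
  g 0 + ∑ (upTo N) (λ x → 0ℚ)         ≡⟨ cong₂ _+_ (ℚP.*-identityˡ (f 0)) (L-0 (∑-linear (upTo N))) ⟩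
  f 0 + 0ℚ                            ∎
  where
  g : ℕ → ℚ
  g x = ⟦ does (x ℕ.≤? 0) ⟧ * f x
∑-upTo-truncate {suc k} {suc N} (s≤s k<N) f = begin
  ∑ (upTo (suc N)) g                       ≡⟨ cong (λ l → ∑ l g) (upTo-suc N) ⟩
  g 0 + ∑ (map suc (upTo N)) g             ≡⟨ cong (g 0 +_) (∑-map suc (upTo N) g) ⟩
  g 0 + ∑ (upTo N) (λ x → g (suc x))       ≡⟨ cong₂ _+_ (ℚP.*-identityˡ (f 0))
                                                (∑-cong (upTo N) (λ x → cong (λ b → ⟦ b ⟧ * f (suc x)) (suc≤?suc x k))) ⟩
  f 0 + ∑ (upTo N) (λ x → ⟦ does (x ℕ.≤? k) ⟧ * f (suc x))
                                           ≡⟨ cong (f 0 +_) (∑-upTo-truncate k<N (f ∘ suc)) ⟩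
  f 0 + ∑ (upTo (suc k)) (f ∘ suc)         ≡⟨ cong (f 0 +_) (∑-map suc (upTo (suc k)) f) ⟨
  f 0 + ∑ (map suc (upTo (suc k))) f       ≡⟨ cong (λ l → ∑ l f) (upTo-suc (suc k)) ⟨
  ∑ (upTo (suc (suc k))) f                 ∎
  where
  g : ℕ → ℚ
  g x = ⟦ does (x ℕ.≤? suc k) ⟧ * f x

-- Weighted counts of parking functions

module ParkingSums (p q r : ℚ) (q+p≡1 : q + p ≡ 1ℚ) (q*r≡1 : q * r ≡ 1ℚ) (N : ℕ) where
  open +-*-Solver using (solve; _:=_; _:+_; _:*_; con)

  entryWeight : ℕ → ℚ
  entryWeight zero    = 1ℚ
  entryWeight (suc j) = pow r (suc j) * p

  weight : List ℕ → ℚ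
  weight []      = 1ℚ
  weight (x ∷ a) = entryWeight x * weight a

  weight-toList : ∀ {n} (a : Vec ℕ n) → weight (toList a) ≡ pow r (Area a) * pow p (suppSize a)
  weight-toList Vec.[]            = refl
  weight-toList (zero Vec.∷ a)    = trans (ℚP.*-identityˡ (weight (toList a))) (weight-toList a)
  weight-toList (suc x Vec.∷ a)   = begin
    pow r (suc x) * p * weight (toList a)
      ≡⟨ cong (pow r (suc x) * p *_) (weight-toList a) ⟩
    pow r (suc x) * p * (pow r (Area a) * pow p (suppSize a))
      ≡⟨ solve 4 (λ u v s t → u :* v :* (s :* t) := (u :* s) :* (v :* t)) refl (pow r (suc x)) p (pow r (Area a)) (pow p (suppSize a)) ⟩
    pow r (suc x) * pow r (Area a) * (p * pow p (suppSize a))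
      ≡⟨ cong (_* (p * pow p (suppSize a))) (pow-+ r (suc x) (Area a)) ⟨
    pow r (suc x ℕ.+ Area a) * (p * pow p (suppSize a)) ∎

  weight-interleaving : ∀ {S R a} → Interleaving S R a → weight a ≡ weight S * weight R
  weight-interleaving [] = refl
  weight-interleaving {x ∷ S} {R} {_ ∷ a} (consˡ sp) = trans (cong (entryWeight x *_) (weight-interleaving sp))
    (sym (ℚP.*-assoc (entryWeight x) (weight S) (weight R)))
  weight-interleaving {S} {x ∷ R} {_ ∷ a} (consʳ sp) = trans (cong (entryWeight x *_) (weight-interleaving sp))
    (solve 3 (λ u v s → u :* (v :* s) := v :* (u :* s)) refl (entryWeight x) (weight S) (weight R))

  -- Since p = 1 - q, the weight of j > 0 is r^j - r^(j-1) and the sum telescopes.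
  ∑-entryWeight : ∀ k → ∑ (upTo (suc k)) entryWeight ≡ pow r k
  ∑-entryWeight zero    = refl
  ∑-entryWeight (suc k) = begin
    ∑ (upTo (suc (suc k))) entryWeight
      ≡⟨ cong (λ l → ∑ l entryWeight) (ListP.upTo-∷ʳ (suc k)) ⟨
    ∑ (upTo (suc k) ++ suc k ∷ []) entryWeight
      ≡⟨ ∑-++ (upTo (suc k)) (suc k ∷ []) entryWeight ⟩
    ∑ (upTo (suc k)) entryWeight + (r * pow r k * p + 0ℚ)
      ≡⟨ cong₂ _+_ (trans (∑-entryWeight k) (sym (ℚP.*-identityˡ (pow r k)))) (ℚP.+-identityʳ (r * pow r k * p)) ⟩
    1ℚ * pow r k + r * pow r k * p
      ≡⟨ cong (λ u → u * pow r k + r * pow r k * p) q*r≡1 ⟨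
    q * r * pow r k + r * pow r k * p
      ≡⟨ solve 4 (λ p q r t → q :* r :* t :+ r :* t :* p := (q :+ p) :* (r :* t)) refl p q r (pow r k) ⟩
    (q + p) * (r * pow r k)
      ≡⟨ cong (_* (r * pow r k)) q+p≡1 ⟩
    1ℚ * (r * pow r k)
      ≡⟨ ℚP.*-identityˡ (r * pow r k) ⟩
    r * pow r k ∎

  -- The entries are independent and each contributes `pow r k` by `∑-entryWeight`. As soon as `m`
  -- is positive, `k + m ≤ N` forces `k < N`, so that all the values from 0 to `k` occur in
  -- `upTo N`.
  ∑-allBelow : ∀ k m → k ℕ.+ m ≤ N →
    ∑ (seqs N m) (λ a → ⟦ allBelow k a ⟧ * weight a) ≡ pow (pow r k) m
  ∑-allBelow k zero    _ = refl
  ∑-allBelow k (suc m) k+1+m≤N = begin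
    ∑ (seqs N (suc m)) (λ a → ⟦ allBelow k a ⟧ * weight a)
      ≡⟨ ∑-seqs-suc N m _ ⟩
    ∑ (upTo N) (λ x → ∑ (seqs N m) (λ a → ⟦ does (x ℕ.≤? k) ∧ allBelow k a ⟧ * (entryWeight x * weight a)))
      ≡⟨ ∑-cong (upTo N) (λ x → trans (∑-cong (seqs N m) (λ a → factor x a)) (L-* (∑-linear (seqs N m)) (⟦ does (x ℕ.≤? k) ⟧ * entryWeight x) _)) ⟩
    ∑ (upTo N) (λ x → (⟦ does (x ℕ.≤? k) ⟧ * entryWeight x) * ∑ (seqs N m) (λ a → ⟦ allBelow k a ⟧ * weight a))
      ≡⟨ ∑-cong (upTo N) (λ x → trans (cong (⟦ does (x ℕ.≤? k) ⟧ * entryWeight x *_) (∑-allBelow k m (ℕP.m+n≤o⇒m≤o (k ℕ.+ m) {1} (subst (_≤ N) (trans (ℕP.+-suc k m) (ℕP.+-comm 1 (k ℕ.+ m))) k+1+m≤N))))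
                                      (ℚP.*-comm (⟦ does (x ℕ.≤? k) ⟧ * entryWeight x) (pow (pow r k) m))) ⟩
    ∑ (upTo N) (λ x → pow (pow r k) m * (⟦ does (x ℕ.≤? k) ⟧ * entryWeight x))
      ≡⟨ L-* (∑-linear (upTo N)) (pow (pow r k) m) _ ⟩
    pow (pow r k) m * ∑ (upTo N) (λ x → ⟦ does (x ℕ.≤? k) ⟧ * entryWeight x)
      ≡⟨ cong (pow (pow r k) m *_) (trans (∑-upTo-truncate k<N entryWeight) (∑-entryWeight k)) ⟩
    pow (pow r k) m * pow r k
      ≡⟨ ℚP.*-comm (pow (pow r k) m) (pow r k) ⟩
    pow r k * pow (pow r k) m ∎
    where
    k<N : k ℕ.< N
    k<N = ℕP.≤-trans (s≤s (ℕP.m≤m+n k m)) (subst (_≤ N) (ℕP.+-suc k m) k+1+m≤N)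
    factor : ∀ x a → ⟦ does (x ℕ.≤? k) ∧ allBelow k a ⟧ * (entryWeight x * weight a) ≡
                     (⟦ does (x ℕ.≤? k) ⟧ * entryWeight x) * (⟦ allBelow k a ⟧ * weight a)
    factor x a = trans (cong (_* (entryWeight x * weight a)) (⟦∧⟧ (does (x ℕ.≤? k)) (allBelow k a)))
      (solve 4 (λ u v s t → (u :* v) :* (s :* t) := (u :* s) :* (v :* t)) refl ⟦ does (x ℕ.≤? k) ⟧ ⟦ allBelow k a ⟧ (entryWeight x) (weight a))

  -- Entries range below the fixed `N` and not below `k`, so that sequences of all lengths share one
  -- alphabet and can be split. For `k ≤ N` no parking function is missed, since its entries are
  -- below `k`.
  parkSum : ℕ → ℚ
  parkSum k = ∑ (seqs N k) (λ a → ⟦ park a ⟧ * weight a)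

  -- With the lengths fixed, the condition on `t` involves `s` only through `k`, and the double sum
  -- factors.
  ∑-weighted-signedPark : ∀ k m → k ℕ.+ m ≤ N →
    ∑ (seqs N k) (λ s → ∑ (seqs N m) (λ t → weight s * weight t * signedPark (s , t))) ≡
    pow (- 1ℚ) m * parkSum k * pow (pow r k) m
  ∑-weighted-signedPark k m k+m≤N = begin
    ∑ (seqs N k) (λ s → ∑ (seqs N m) (λ t → weight s * weight t * signedPark (s , t)))
      ≡⟨ ∑-cong-All (seqs-length N k) (λ {s} |s|≡k → trans
           (∑-cong-All (seqs-length N m) (λ {t} |t|≡m → separate {s} {t} |s|≡k |t|≡m))
           (L-* (∑-linear (seqs N m)) (pow (- 1ℚ) m * (⟦ park s ⟧ * weight s)) (λ t → ⟦ allBelow k t ⟧ * weight t))) ⟩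
    ∑ (seqs N k) (λ s → pow (- 1ℚ) m * (⟦ park s ⟧ * weight s) * ∑ (seqs N m) (λ t → ⟦ allBelow k t ⟧ * weight t))
      ≡⟨ ∑-cong (seqs N k) (λ s → trans (cong (pow (- 1ℚ) m * (⟦ park s ⟧ * weight s) *_) (∑-allBelow k m k+m≤N))
           (solve 3 (λ u v s → u :* v :* s := (u :* s) :* v) refl (pow (- 1ℚ) m) (⟦ park s ⟧ * weight s) (pow (pow r k) m))) ⟩
    ∑ (seqs N k) (λ s → pow (- 1ℚ) m * pow (pow r k) m * (⟦ park s ⟧ * weight s))
      ≡⟨ L-* (∑-linear (seqs N k)) (pow (- 1ℚ) m * pow (pow r k) m) _ ⟩
    pow (- 1ℚ) m * pow (pow r k) m * parkSum k
      ≡⟨ solve 3 (λ u v s → u :* v :* s := (u :* s) :* v) refl (pow (- 1ℚ) m) (pow (pow r k) m) (parkSum k) ⟩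
    pow (- 1ℚ) m * parkSum k * pow (pow r k) m ∎
    where
    separate : ∀ {s t} → length s ≡ k → length t ≡ m → weight s * weight t * signedPark (s , t) ≡
      pow (- 1ℚ) m * (⟦ park s ⟧ * weight s) * (⟦ allBelow k t ⟧ * weight t)
    separate {s} {t} refl refl = trans
      (cong (λ z → weight s * weight t * (pow (- 1ℚ) m * z)) (⟦∧⟧ (park s) (allBelow k t)))
      (solve 5 (λ a b c d e → a :* b :* (c :* (d :* e)) := c :* (d :* a) :* (e :* b)) refl
        (weight s) (weight t) (pow (- 1ℚ) m) ⟦ park s ⟧ ⟦ allBelow k t ⟧)

  -- A double count of weighted signed splits: for a fixed split of the positions the sum factors,
  -- and for a fixed sequence it cancels by `∑-signedPark`, because the weight of a sequence does
  -- not depend on how it is split.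
  ∑-splits-parkSum : (v : A) (vs : List A) → length (v ∷ vs) ≤ N →
    ∑ (splits (v ∷ vs)) (λ (S , R) → pow (- 1ℚ) (length R) * parkSum (length S) * pow (pow r (length S)) (length R)) ≡ 0ℚ
  ∑-splits-parkSum v vs len = begin
    ∑ (splits (v ∷ vs)) (λ (S , R) → pow (- 1ℚ) (length R) * parkSum (length S) * pow (pow r (length S)) (length R))
      ≡⟨ ∑-splits-cong (v ∷ vs) (λ {S} {R} sp → ∑-weighted-signedPark (length S) (length R) (subst (_≤ N) (interleaving-length sp) len)) ⟨
    ∑ (splits (v ∷ vs)) (λ (S , R) → ∑ (seqs N (length S)) (λ s → ∑ (seqs N (length R)) (λ t → weight s * weight t * signedPark (s , t))))
      ≡⟨ ∑-seqs-splits N (v ∷ vs) (λ (s , t) → weight s * weight t * signedPark (s , t)) ⟨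
    ∑ (seqs N (suc (length vs))) (λ a → ∑ (splits a) (λ (s , t) → weight s * weight t * signedPark (s , t)))
      ≡⟨ ∑-cong-All (seqs-length N (suc (length vs))) (λ {a} → cancel {a}) ⟩
    ∑ (seqs N (suc (length vs))) (λ _ → 0ℚ)
      ≡⟨ L-0 (∑-linear (seqs N (suc (length vs)))) ⟩
    0ℚ ∎
    where
    cancel : ∀ {a} → length a ≡ suc (length vs) → ∑ (splits a) (λ (s , t) → weight s * weight t * signedPark (s , t)) ≡ 0ℚ
    cancel {x ∷ a} _ = begin
      ∑ (splits (x ∷ a)) (λ (s , t) → weight s * weight t * signedPark (s , t))
        ≡⟨ ∑-splits-cong (x ∷ a) (λ {s} {t} sp → cong (_* signedPark (s , t)) (weight-interleaving sp)) ⟨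
      ∑ (splits (x ∷ a)) (λ (s , t) → weight (x ∷ a) * signedPark (s , t))
        ≡⟨ L-* (∑-linear (splits (x ∷ a))) (weight (x ∷ a)) signedPark ⟩
      weight (x ∷ a) * ∑ (splits (x ∷ a)) signedPark
        ≡⟨ cong (weight (x ∷ a) *_) (∑-signedPark x a) ⟩
      weight (x ∷ a) * 0ℚ
        ≡⟨ ℚP.*-zeroʳ (weight (x ∷ a)) ⟩
      0ℚ ∎

  scaledParkSum : ℕ → ℚ
  scaledParkSum k = pow q (k C 2) * parkSum k

  -- The crossing pairs contribute `pow q (k * m)`, which cancels `pow r (k * m)`.
  pow-C2-split : ∀ k m → pow q ((k ℕ.+ m) C 2) * pow (pow r k) m ≡ pow q (k C 2) * pow q (m C 2)
  pow-C2-split k m = begin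
    pow q ((k ℕ.+ m) C 2) * pow (pow r k) m
      ≡⟨ cong₂ _*_ (cong (pow q) ([m+n]C2 k m)) (pow-* r k m) ⟩
    pow q (k C 2 ℕ.+ m C 2 ℕ.+ k ℕ.* m) * pow r (k ℕ.* m)
      ≡⟨ cong (_* pow r (k ℕ.* m)) (trans (pow-+ q (k C 2 ℕ.+ m C 2) (k ℕ.* m)) (cong (_* pow q (k ℕ.* m)) (pow-+ q (k C 2) (m C 2)))) ⟩
    pow q (k C 2) * pow q (m C 2) * pow q (k ℕ.* m) * pow r (k ℕ.* m)
      ≡⟨ ℚP.*-assoc (pow q (k C 2) * pow q (m C 2)) (pow q (k ℕ.* m)) (pow r (k ℕ.* m)) ⟩
    pow q (k C 2) * pow q (m C 2) * (pow q (k ℕ.* m) * pow r (k ℕ.* m))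
      ≡⟨ cong (pow q (k C 2) * pow q (m C 2) *_) (pow-inverse q*r≡1 (k ℕ.* m)) ⟩
    pow q (k C 2) * pow q (m C 2) * 1ℚ
      ≡⟨ ℚP.*-identityʳ (pow q (k C 2) * pow q (m C 2)) ⟩
    pow q (k C 2) * pow q (m C 2) ∎

  -- The recursion for `parkSum` multiplied by `pow q (n C 2)`, with `n` the length of the whole
  -- list. The two parts are exchanged so that the coefficients match those of the recursion for
  -- acyclic digraphs.
  ∑-splits-scaledParkSum : (v : A) (vs : List A) → length (v ∷ vs) ≤ N →
    ∑ (splits (v ∷ vs)) (λ (S , R) → pow (- 1ℚ) (length S) * pow q (length S C 2) * scaledParkSum (length R)) ≡ 0ℚ
  ∑-splits-scaledParkSum v vs len = begin
    ∑ (splits (v ∷ vs)) (λ (S , R) → pow (- 1ℚ) (length S) * pow q (length S C 2) * scaledParkSum (length R))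
      ≡⟨ ∑-splits-swap (v ∷ vs) _ ⟩
    ∑ (splits (v ∷ vs)) (λ (S , R) → pow (- 1ℚ) (length R) * pow q (length R C 2) * scaledParkSum (length S))
      ≡⟨ ∑-splits-cong (v ∷ vs) (λ {S} {R} sp → rescale (length S) (length R) (interleaving-length sp)) ⟩
    ∑ (splits (v ∷ vs)) (λ (S , R) → pow q (n C 2) * (pow (- 1ℚ) (length R) * parkSum (length S) * pow (pow r (length S)) (length R)))
      ≡⟨ L-* (∑-linear (splits (v ∷ vs))) (pow q (n C 2)) _ ⟩
    pow q (n C 2) * ∑ (splits (v ∷ vs)) (λ (S , R) → pow (- 1ℚ) (length R) * parkSum (length S) * pow (pow r (length S)) (length R))
      ≡⟨ cong (pow q (n C 2) *_) (∑-splits-parkSum v vs len) ⟩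
    pow q (n C 2) * 0ℚ
      ≡⟨ ℚP.*-zeroʳ (pow q (n C 2)) ⟩
    0ℚ ∎
    where
    n : ℕ
    n = length (v ∷ vs)
    rescale : ∀ k m → n ≡ k ℕ.+ m → pow (- 1ℚ) m * pow q (m C 2) * scaledParkSum k ≡
      pow q (n C 2) * (pow (- 1ℚ) m * parkSum k * pow (pow r k) m)
    rescale k m n≡k+m = begin
      pow (- 1ℚ) m * pow q (m C 2) * (pow q (k C 2) * parkSum k)
        ≡⟨ solve 4 (λ a b c d → a :* b :* (c :* d) := c :* b :* (a :* d)) refl (pow (- 1ℚ) m) (pow q (m C 2)) (pow q (k C 2)) (parkSum k) ⟩
      pow q (k C 2) * pow q (m C 2) * (pow (- 1ℚ) m * parkSum k)
        ≡⟨ cong (_* (pow (- 1ℚ) m * parkSum k)) (pow-C2-split k m) ⟨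
      pow q ((k ℕ.+ m) C 2) * pow (pow r k) m * (pow (- 1ℚ) m * parkSum k)
        ≡⟨ cong (λ l → pow q (l C 2) * pow (pow r k) m * (pow (- 1ℚ) m * parkSum k)) n≡k+m ⟨
      pow q (n C 2) * pow (pow r k) m * (pow (- 1ℚ) m * parkSum k)
        ≡⟨ solve 3 (λ a b c → a :* b :* c := a :* (c :* b)) refl (pow q (n C 2)) (pow (pow r k) m) (pow (- 1ℚ) m * parkSum k) ⟩
      pow q (n C 2) * (pow (- 1ℚ) m * parkSum k * pow (pow r k) m) ∎

-- Directed cycles

private variable
  n : ℕ

Arc : ℕ → Set
Arc n = Fin n × Fin n

==⇒≡ : {u v : Fin n} → T (u == v) → u ≡ v
==⇒≡ {u = u} {v} t with u FinP.≟ v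
... | yes u≡v = u≡v

==-refl : (u : Fin n) → T (u == u)
==-refl u = Equivalence.from BoolP.T-≡ (dec-true (u FinP.≟ u) refl)

≢⇒==-false : {u v : Fin n} → u ≢ v → (u == v) ≡ false
≢⇒==-false {u = u} {v} = dec-false (u FinP.≟ v)

arc⁻ : (D : List (Arc n)) {u v : Fin n} → T (arc D u v) → (u , v) ∈ D
arc⁻ ((a , b) ∷ D) t with Equivalence.to BoolP.T-∨ t
... | inj₂ t′ = there (arc⁻ D t′)
... | inj₁ t′ with Equivalence.to BoolP.T-∧ t′
... | a==u , b==v = here (sym (cong₂ _,_ (==⇒≡ {u = a} a==u) (==⇒≡ {u = b} b==v)))

arc⁺ : {D : List (Arc n)} {u v : Fin n} → (u , v) ∈ D → T (arc D u v)
arc⁺ {u = u} {v} (here refl) = Equivalence.from BoolP.T-∨ (inj₁ (Equivalence.from BoolP.T-∧ (==-refl u , ==-refl v)))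
arc⁺ (there uv∈D) = Equivalence.from BoolP.T-∨ (inj₂ (arc⁺ uv∈D))

data Walk (D : List (Arc n)) : ℕ → Fin n → Fin n → Set where
  []  : ∀ {u} → Walk D 0 u u
  _∷_ : ∀ {k u w v} → (u , w) ∈ D → Walk D k w v → Walk D (suc k) u v

walk⁻ : (D : List (Arc n)) (k : ℕ) {u v : Fin n} → T (walk D k u v) → Walk D k u v
walk⁻ D zero {u} {v} t with refl ← ==⇒≡ {u = u} {v} t = []
walk⁻ {n} D (suc k) {u} {v} t with find (AnyP.any⁻ (λ w → arc D u w ∧ walk D k w v) (allFin n) t)
... | w , _ , t′ with Equivalence.to BoolP.T-∧ t′
... | uw , wv = arc⁻ D uw ∷ walk⁻ D k wv

walk⁺ : {D : List (Arc n)} {k : ℕ} {u v : Fin n} → Walk D k u v → T (walk D k u v)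
walk⁺ {u = u} []    = ==-refl u
walk⁺ {D = D} {u = u} {v} (_∷_ {k} {w = w} uw wv) = AnyP.any⁺ (λ x → arc D u x ∧ walk D k x v)
  (lose (∈-allFin w) (Equivalence.from BoolP.T-∧ (arc⁺ uw , walk⁺ wv)))

Cyclic : List (Arc n) → Set
Cyclic {n} D = ∃[ v ] ∃[ k ] (k ℕ.< n) × Walk D (suc k) v v

cyclic⁻ : (D : List (Arc n)) → T (hasDirectedCycle D) → Cyclic D
cyclic⁻ {n} D t with find (AnyP.any⁻ (λ v → any (λ k → walk D (suc k) v v) (upTo n)) (allFin n) t)
... | v , _ , t′ with find (AnyP.any⁻ (λ k → walk D (suc k) v v) (upTo n) t′)
... | k , k∈ , t″ = v , k , ∈-upTo⁻ k∈ , walk⁻ D (suc k) t″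

cyclic⁺ : {D : List (Arc n)} → Cyclic D → T (hasDirectedCycle D)
cyclic⁺ {n} {D} (v , k , k<n , vv) = AnyP.any⁺ (λ v → any (λ k → walk D (suc k) v v) (upTo n))
  (lose (∈-allFin v) (AnyP.any⁺ (λ k → walk D (suc k) v v) (lose (∈-upTo⁺ k<n) (walk⁺ vv))))

T-ext : {a b : Bool} → (T a → T b) → (T b → T a) → a ≡ b
T-ext {true}  {true}  f g = refl
T-ext {false} {false} f g = refl
T-ext {true}  {false} f g = ⊥-elim (f tt)
T-ext {false} {true}  f g = ⊥-elim (g tt)

acyclic : List (Arc n) → Bool
acyclic D = not (hasDirectedCycle D)

walk-mono : {D E : List (Arc n)} → (∀ {e} → e ∈ D → e ∈ E) → ∀ {k u v} → Walk D k u v → Walk E k u v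
walk-mono D⊆E []        = []
walk-mono D⊆E (uw ∷ wv) = D⊆E uw ∷ walk-mono D⊆E wv

-- Vertex classes and sources

within : (A → Bool) → List (A × A) → List (A × A)
within c = filterᵇ (λ (u , v) → c u ∧ c v)

headsAvoid : (Fin n → Bool) → List (Arc n) → Bool
headsAvoid c = all (λ (_ , v) → not (c v))

-- Every vertex of a closed walk is the head of one of its arcs. If no head lies in the class `c`, a
-- closed walk therefore avoids `c` and survives the restriction.
acyclic-within : (c : Fin n → Bool) (D : List (Arc n)) → T (headsAvoid c D) → acyclic (within (not ∘ c) D) ≡ acyclic D
acyclic-within {n} c D avoid = cong not (T-ext
  (λ t → let v , k , k<n , vv = cyclic⁻ (within (not ∘ c) D) t in
         cyclic⁺ {D = D} (v , k , k<n , walk-mono (proj₁ ∘ ∈-filter⁻ avoids?) vv))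
  (λ t → let v , k , k<n , vv = cyclic⁻ D t in
         cyclic⁺ {D = within (not ∘ c) D} (v , k , k<n , confine (end vv) vv)))
  where
  avoids? : (e : Arc n) → Dec (T (not (c (proj₁ e)) ∧ not (c (proj₂ e))))
  avoids? e = T? _
  heads : ∀ {u v} → (u , v) ∈ D → T (not (c v))
  heads = All.lookup (AllP.all⁺ _ D avoid)
  end : ∀ {k u v} → Walk D (suc k) u v → T (not (c v))
  end (uv ∷ [])          = heads uv
  end (_ ∷ wv@(_ ∷ _))   = end wv
  confine : ∀ {k u v} → T (not (c u)) → Walk D k u v → Walk (within (not ∘ c) D) k u v
  confine c̸u []        = []
  confine c̸u (uw ∷ wv) = ∈-filter⁺ avoids? uw (Equivalence.from BoolP.T-∧ (c̸u , heads uw)) ∷ confine (heads uw) wv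

isSource : List (Arc n) → Fin n → Bool
isSource D s = all (λ (_ , v) → not (s == v)) D

mem : List (Fin n) → Fin n → Bool
mem S v = any (_== v) S

all-∧ : (f g : A → Bool) (xs : List A) → all (λ x → f x ∧ g x) xs ≡ all f xs ∧ all g xs
all-∧ f g []       = refl
all-∧ f g (x ∷ xs) with f x | g x
... | true  | true  = all-∧ f g xs
... | true  | false = sym (BoolP.∧-zeroʳ (all f xs))
... | false | _     = refl

all-cong : {f g : A → Bool} → (∀ x → f x ≡ g x) → (xs : List A) → all f xs ≡ all g xs
all-cong eq []       = refl
all-cong eq (x ∷ xs) = cong₂ _∧_ (eq x) (all-cong eq xs)

-- Exchanges the quantifiers over arcs and over `S`. The left form can be evaluated edge by edge;
-- the right form suits inclusion-exclusion over sets of sources.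
headsAvoid-mem : (S : List (Fin n)) (D : List (Arc n)) → headsAvoid (mem S) D ≡ all (isSource D) S
headsAvoid-mem []      D = all-true D
  where
  all-true : (D : List (Arc n)) → headsAvoid (mem []) D ≡ true
  all-true []      = refl
  all-true (_ ∷ D) = all-true D
headsAvoid-mem (s ∷ S) D = begin
  all (λ (_ , v) → not ((s == v) ∨ mem S v)) D           ≡⟨ all-cong (λ (_ , v) → deMorgan (s == v) (mem S v)) D ⟩
  all (λ (_ , v) → not (s == v) ∧ not (mem S v)) D       ≡⟨ all-∧ (λ (_ , v) → not (s == v)) (λ (_ , v) → not (mem S v)) D ⟩
  isSource D s ∧ headsAvoid (mem S) D                    ≡⟨ cong (isSource D s ∧_) (headsAvoid-mem S D) ⟩
  isSource D s ∧ all (isSource D) S                      ∎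
  where
  deMorgan : ∀ a b → not (a ∨ b) ≡ not a ∧ not b
  deMorgan true  b = refl
  deMorgan false b = refl

notSource⇒arc : (D : List (Arc n)) {v : Fin n} → T (not (isSource D v)) → ∃[ u ] (u , v) ∈ D
notSource⇒arc ((u , w) ∷ D) {v} t with v FinP.≟ w
... | yes refl = u , here refl
... | no  _    = let u , uv∈D = notSource⇒arc D t in u , there uv∈D

-- Walking backwards along arcs must revisit a vertex.
noSource⇒cyclic : {D : List (Arc n)} {vs : List (Fin n)} → All (λ (u , v) → u ∈ vs × v ∈ vs) D →
  T (all (not ∘ isSource D) vs) → ∀ {v} → v ∈ vs → Cyclic D
noSource⇒cyclic {n} {D} {vs} inside t {v₀} v₀∈vs =
  -- Among the `n + 1` vertices `back 0`, ..., `back n` two coincide. The closed walk between them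
  -- has length `j - i`, at most `n`, as `Cyclic` demands.
  let i , j , i<j , eq = FinP.pigeonhole (ℕP.n<1+n n) (λ i → proj₁ (back (toℕ i)))
  in close i<j (FinP.toℕ≤pred[n] j) eq
  where
  prev : ∃ (_∈ vs) → ∃ (_∈ vs)
  prev (v , v∈vs) = let u , uv∈D = notSource⇒arc D (All.lookup (AllP.all⁺ _ vs t) v∈vs) in u , proj₁ (All.lookup inside uv∈D)
  prev-arc : (x : ∃ (_∈ vs)) → (proj₁ (prev x) , proj₁ x) ∈ D
  prev-arc (v , v∈vs) = proj₂ (notSource⇒arc D (All.lookup (AllP.all⁺ _ vs t) v∈vs))
  back : ℕ → ∃ (_∈ vs)
  back zero    = v₀ , v₀∈vs
  back (suc i) = prev (back i)
  back-walk : ∀ k i → Walk D k (proj₁ (back (k ℕ.+ i))) (proj₁ (back i))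
  back-walk zero    i = []
  back-walk (suc k) i = prev-arc (back (k ℕ.+ i)) ∷ back-walk k i
  close : ∀ {i j} → i ℕ.< j → j ≤ n → proj₁ (back i) ≡ proj₁ (back j) → Cyclic D
  close {i} {j} i<j j≤n eq = proj₁ (back i) , j ∸ suc i , k<n ,
    subst (λ x → Walk D (suc (j ∸ suc i)) x (proj₁ (back i)))
      (trans (cong (proj₁ ∘ back) (trans (sym (ℕP.+-suc (j ∸ suc i) i)) (ℕP.m∸n+n≡m i<j))) (sym eq))
      (back-walk (suc (j ∸ suc i)) i)
    where
    k<n : j ∸ suc i ℕ.< n
    k<n = ℕP.≤-trans (subst (suc (j ∸ suc i) ≤_) (ℕP.m∸n+n≡m i<j)
      (subst (_≤ j ∸ suc i ℕ.+ suc i) (ℕP.+-comm (j ∸ suc i) 1) (ℕP.+-monoʳ-≤ (j ∸ suc i) (s≤s z≤n)))) j≤n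

-- Complete graphs on lists of vertices

pairsOf : List A → List (A × A)
pairsOf []       = []
pairsOf (v ∷ vs) = map (v ,_) vs ++ pairsOf vs

length-pairsOf : (vs : List A) → length (pairsOf vs) ≡ length vs C 2
length-pairsOf []       = refl
length-pairsOf (v ∷ vs) = begin
  length (map (v ,_) vs ++ pairsOf vs)              ≡⟨ ListP.length-++ (map (v ,_) vs) ⟩
  length (map (v ,_) vs) ℕ.+ length (pairsOf vs)    ≡⟨ cong₂ ℕ._+_ (ListP.length-map (v ,_) vs) (length-pairsOf vs) ⟩
  length vs ℕ.+ length vs C 2                       ≡⟨ [1+n]C2 (length vs) ⟨
  suc (length vs) C 2                               ∎

pairsOf-∈ : (vs : List A) → All (λ (u , v) → u ∈ vs × v ∈ vs) (pairsOf vs)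
pairsOf-∈ []       = []
pairsOf-∈ (v ∷ vs) = AllP.++⁺
  (AllP.map⁺ (All.tabulate (λ w∈vs → here refl , there w∈vs)))
  (All.map (λ (u∈ , w∈) → there u∈ , there w∈) (pairsOf-∈ vs))

within-pairsOf : (c : A → Bool) (vs : List A) → within c (pairsOf vs) ≡ pairsOf (filterᵇ c vs)
within-pairsOf c []       = refl
within-pairsOf c (v ∷ vs) = trans (ListP.filter-++ (λ e → T? _) (map (v ,_) vs) (pairsOf vs)) (tail (c v) refl)
  where
  star : ∀ b → c v ≡ b → (ws : List _) → within c (map (v ,_) ws) ≡ (if b then map (v ,_) (filterᵇ c ws) else [])
  star true  eq []       = refl
  star false eq []       = refl
  star true  eq (w ∷ ws) rewrite eq with c w
  ... | true  = cong ((v , w) ∷_) (star true eq ws)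
  ... | false = star true eq ws
  star false eq (w ∷ ws) rewrite eq = star false eq ws
  tail : ∀ b → c v ≡ b → within c (map (v ,_) vs) ++ within c (pairsOf vs) ≡ pairsOf (filterᵇ c (v ∷ vs))
  tail true  eq rewrite star true  eq vs | eq = cong (map (v ,_) (filterᵇ c vs) ++_) (within-pairsOf c vs)
  tail false eq rewrite star false eq vs | eq = within-pairsOf c vs

-- The double loop of `pairs` with separate lists for rows and columns: in the induction the
-- smallest vertex is dropped from the columns while the later rows are kept.
increasingPairs : List (Fin n) → List (Fin n) → List (Arc n)
increasingPairs us vs = concatMap (λ i → concatMap (λ j → if does (toℕ i ℕ.<? toℕ j) then (i , j) ∷ [] else []) vs) us

length-allFin : ∀ n → length (allFin n) ≡ n
length-allFin n = ListP.length-tabulate {n = n} id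

-- `allFin n` is increasing, so the test in `pairs` keeps, for each vertex, exactly the vertices
-- listed after it.
pairs≡pairsOf : ∀ n → pairs n ≡ pairsOf (allFin n)
pairs≡pairsOf n = increasing (AllPairsP.tabulate⁺-< id)
  where
  row : Fin n → List (Fin n) → List (Arc n)
  row i = concatMap (λ j → if does (toℕ i ℕ.<? toℕ j) then (i , j) ∷ [] else [])
  row-above : ∀ {i} {vs : List (Fin n)} → All (i Fin.<_) vs → row i vs ≡ map (i ,_) vs
  row-above [] = refl
  row-above {i} {v ∷ vs} (i<v ∷ i<vs) rewrite dec-true (toℕ i ℕ.<? toℕ v) i<v = cong ((i , v) ∷_) (row-above i<vs)
  row-skip : ∀ {i v} (vs : List (Fin n)) → ¬ (i Fin.< v) → row i (v ∷ vs) ≡ row i vs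
  row-skip {i} {v} vs i≮v rewrite dec-false (toℕ i ℕ.<? toℕ v) i≮v = refl
  rows-skip : ∀ {v} {us : List (Fin n)} (vs : List (Fin n)) → All (v Fin.<_) us → increasingPairs us (v ∷ vs) ≡ increasingPairs us vs
  rows-skip vs []           = refl
  rows-skip {v} {u ∷ us} vs (v<u ∷ v<us) = cong₂ _++_ (row-skip {u} {v} vs (ℕP.<-asym v<u)) (rows-skip vs v<us)
  increasing : {vs : List (Fin n)} → AllPairs Fin._<_ vs → increasingPairs vs vs ≡ pairsOf vs
  increasing []                    = refl
  increasing {v ∷ vs} (v<vs ∷ inc) = cong₂ _++_
    (trans (row-skip {v} {v} vs (ℕP.<-irrefl refl)) (row-above v<vs))
    (trans (rows-skip vs v<vs) (increasing inc))

filterᵇ-cong-All : {f g : A → Bool} {xs : List A} → All (λ x → f x ≡ g x) xs → filterᵇ f xs ≡ filterᵇ g xs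
filterᵇ-cong-All []         = refl
filterᵇ-cong-All {g = g} {x ∷ xs} (eq ∷ eqs) rewrite eq with g x
... | true  = cong (x ∷_) (filterᵇ-cong-All eqs)
... | false = filterᵇ-cong-All eqs

mem-false : {x : Fin n} {S : List (Fin n)} → All (x ≢_) S → mem S x ≡ false
mem-false []           = refl
mem-false {x = x} {s ∷ S} (x≢s ∷ x≢S) rewrite ≢⇒==-false {u = s} {x} (x≢s ∘ sym) = mem-false x≢S

mem-∷-≢ : {x : Fin n} {S xs : List (Fin n)} → All (x ≢_) xs → All (λ y → mem (x ∷ S) y ≡ mem S y) xs
mem-∷-≢ {x = x} {S} = All.map (λ {y} x≢y → cong (_∨ mem S y) (≢⇒==-false x≢y))

-- Splits choose positions, whereas a colouring by `mem S` looks at values. In a list without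
-- repetitions the two agree.
filter-mem : {S R xs : List (Fin n)} → Unique xs → Interleaving S R xs →
  filterᵇ (mem S) xs ≡ S × filterᵇ (not ∘ mem S) xs ≡ R
filter-mem [] [] = refl , refl
filter-mem {S = x ∷ S} (x≢xs ∷ uniq) (consˡ sp)
  rewrite dec-true (x FinP.≟ x) refl
  with S≡ , R≡ ← filter-mem uniq sp =
  cong (x ∷_) (trans (filterᵇ-cong-All (mem-∷-≢ {S = S} x≢xs)) S≡) ,
  trans (filterᵇ-cong-All (All.map (cong not) (mem-∷-≢ {S = S} x≢xs))) R≡
filter-mem {S = S} {x ∷ R} (x≢xs ∷ uniq) (consʳ sp)
  rewrite mem-false {x = x} {S} (proj₁ (interleaving-All sp x≢xs))
  with S≡ , R≡ ← filter-mem uniq sp = S≡ , cong (x ∷_) R≡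

-- Weighted sums over partial orientations

module OrientationSums (p q : ℚ) (q+p≡1 : q + p ≡ 1ℚ) where
  open +-*-Solver using (solve; _:=_; _:+_; _:*_; con)

  -- Each pair is absent with weight `q` or carries one of its two directions with weight `p` each.
  -- The total weight of a pair is `q + 2p`, not 1, because both orientations of a present edge are
  -- counted.
  orientSum : List (Arc n) → (List (Arc n) → ℚ) → ℚ
  orientSum []             f = f []
  orientSum ((i , j) ∷ es) f =
    q * orientSum es f + p * (orientSum es (λ D → f ((i , j) ∷ D)) + orientSum es (λ D → f ((j , i) ∷ D)))

  -- `P` has to be symmetric because every edge also occurs reversed.
  orientSum-cong-All : {P : Arc n → Set} → (∀ {i j} → P (i , j) → P (j , i)) → {es : List (Arc n)} → All P es →
    {f g : List (Arc n) → ℚ} → (∀ D → All P D → f D ≡ g D) → orientSum es f ≡ orientSum es g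
  orientSum-cong-All sym-P []         eq = eq [] []
  orientSum-cong-All sym-P (pe ∷ pes) eq = cong₂ (λ x y → q * x + p * y)
    (orientSum-cong-All sym-P pes eq)
    (cong₂ _+_ (orientSum-cong-All sym-P pes (λ D pD → eq _ (pe ∷ pD)))
               (orientSum-cong-All sym-P pes (λ D pD → eq _ (sym-P pe ∷ pD))))

  orientSum-linear : (es : List (Arc n)) → Linear (orientSum es)
  orientSum-linear []             = record
    { L-cong = λ eq → eq []
    ; L-+    = λ _ _ → refl
    ; L-*    = λ _ _ → refl
    }
  orientSum-linear (e@(i , j) ∷ es) = record
    { L-cong = λ eq → cong₂ (λ x y → q * x + p * y) (L-cong rec eq) (cong₂ _+_ (L-cong rec (λ D → eq _)) (L-cong rec (λ D → eq _)))
    ; L-+ = λ f g → trans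
        (cong₂ (λ x y → q * x + p * y) (L-+ rec f g)
          (cong₂ _+_ (L-+ rec (λ D → f (e ∷ D)) (λ D → g (e ∷ D))) (L-+ rec (λ D → f ((j , i) ∷ D)) (λ D → g ((j , i) ∷ D)))))
        (solve 8 (λ p q a b c d x y → q :* (a :+ b) :+ p :* ((c :+ d) :+ (x :+ y)) :=
                                      (q :* a :+ p :* (c :+ x)) :+ (q :* b :+ p :* (d :+ y))) refl
          p q (orientSum es f) (orientSum es g)
          (orientSum es (λ D → f (e ∷ D))) (orientSum es (λ D → g (e ∷ D)))
          (orientSum es (λ D → f ((j , i) ∷ D))) (orientSum es (λ D → g ((j , i) ∷ D))))
    ; L-* = λ c f → trans
        (cong₂ (λ x y → q * x + p * y) (L-* rec c f)
          (cong₂ _+_ (L-* rec c (λ D → f (e ∷ D))) (L-* rec c (λ D → f ((j , i) ∷ D)))))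
        (solve 6 (λ p q c a b d → q :* (c :* a) :+ p :* (c :* b :+ c :* d) := c :* (q :* a :+ p :* (b :+ d))) refl
          p q c (orientSum es f) (orientSum es (λ D → f (e ∷ D))) (orientSum es (λ D → f ((j , i) ∷ D))))
    }
    where
    rec : Linear (orientSum es)
    rec = orientSum-linear es

  ∑-orientations : (i j : Fin n) (es : List (Arc n)) (f : List (Arc n) → ℚ) →
    ∑ (orientations ((i , j) ∷ es)) f ≡ ∑ (orientations es) (λ D → f ((i , j) ∷ D)) + ∑ (orientations es) (λ D → f ((j , i) ∷ D))
  ∑-orientations i j es f = trans (∑-++ (map ((i , j) ∷_) (orientations es)) _ f)
    (cong₂ _+_ (∑-map _ (orientations es) f) (∑-map _ (orientations es) f))

  sublists-length : (xs : List A) → All (λ ys → length ys ≤ length xs) (sublists xs)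
  sublists-length []       = z≤n ∷ []
  sublists-length (x ∷ xs) = AllP.++⁺ (All.map ℕP.m≤n⇒m≤1+n (sublists-length xs)) (AllP.map⁺ (All.map s≤s (sublists-length xs)))

  graphWeight : ℕ → ℕ → ℚ
  graphWeight m k = pow p k * pow q (m ∸ k)

  -- Choosing a graph and then orienting it is a separate decision for each edge: leave it out, or
  -- keep it and pick a direction.
  ∑-sublists-orientations : (es : List (Arc n)) (f : List (Arc n) → ℚ) →
    ∑ (sublists es) (λ G → graphWeight (length es) (length G) * ∑ (orientations G) f) ≡ orientSum es f
  ∑-sublists-orientations [] f = trans (ℚP.+-identityʳ (1ℚ * (f [] + 0ℚ))) (trans (ℚP.*-identityˡ (f [] + 0ℚ)) (ℚP.+-identityʳ (f [])))
  ∑-sublists-orientations ((i , j) ∷ es) f = begin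
    ∑ (sublists ((i , j) ∷ es)) (term (suc m) f)
      ≡⟨ ∑-++ (sublists es) (map ((i , j) ∷_) (sublists es)) (term (suc m) f) ⟩
    ∑ (sublists es) (term (suc m) f) + ∑ (map ((i , j) ∷_) (sublists es)) (term (suc m) f)
      ≡⟨ cong₂ _+_ absent present ⟩
    q * orientSum es f + p * (orientSum es fᵢⱼ + orientSum es fⱼᵢ) ∎
    where
    m : ℕ
    m = length es
    term : ℕ → (List (Arc _) → ℚ) → List (Arc _) → ℚ
    term l g G = graphWeight l (length G) * ∑ (orientations G) g
    fᵢⱼ fⱼᵢ : List (Arc _) → ℚ
    fᵢⱼ D = f ((i , j) ∷ D)
    fⱼᵢ D = f ((j , i) ∷ D)
    absent : ∑ (sublists es) (term (suc m) f) ≡ q * orientSum es f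
    absent = begin
      ∑ (sublists es) (term (suc m) f)
        -- The truncated difference `suc m ∸ length G` equals `suc (m ∸ length G)` only because
        -- `length G ≤ m`.
        ≡⟨ ∑-cong-All (sublists-length es) (λ {G} |G|≤m → trans
             (cong (λ l → pow p (length G) * pow q l * ∑ (orientations G) f) (ℕP.+-∸-assoc 1 |G|≤m))
             (solve 4 (λ q a b c → a :* (q :* b) :* c := q :* (a :* b :* c)) refl q (pow p (length G)) (pow q (m ∸ length G)) (∑ (orientations G) f))) ⟩
      ∑ (sublists es) (λ G → q * term m f G)
        ≡⟨ L-* (∑-linear (sublists es)) q (term m f) ⟩
      q * ∑ (sublists es) (term m f)
        ≡⟨ cong (q *_) (∑-sublists-orientations es f) ⟩
      q * orientSum es f ∎
    present : ∑ (map ((i , j) ∷_) (sublists es)) (term (suc m) f) ≡ p * (orientSum es fᵢⱼ + orientSum es fⱼᵢ)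
    present = begin
      ∑ (map ((i , j) ∷_) (sublists es)) (term (suc m) f)
        ≡⟨ ∑-map ((i , j) ∷_) (sublists es) (term (suc m) f) ⟩
      ∑ (sublists es) (λ G → p * pow p (length G) * pow q (m ∸ length G) * ∑ (orientations ((i , j) ∷ G)) f)
        ≡⟨ ∑-cong (sublists es) (λ G → trans
             (cong (p * pow p (length G) * pow q (m ∸ length G) *_) (∑-orientations i j G f))
             (solve 5 (λ p a b c d → p :* a :* b :* (c :+ d) := p :* (a :* b :* c :+ a :* b :* d)) refl
               p (pow p (length G)) (pow q (m ∸ length G)) (∑ (orientations G) fᵢⱼ) (∑ (orientations G) fⱼᵢ))) ⟩
      ∑ (sublists es) (λ G → p * (term m fᵢⱼ G + term m fⱼᵢ G))
        ≡⟨ L-* (∑-linear (sublists es)) p (λ G → term m fᵢⱼ G + term m fⱼᵢ G) ⟩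
      p * ∑ (sublists es) (λ G → term m fᵢⱼ G + term m fⱼᵢ G)
        ≡⟨ cong (p *_) (trans (L-+ (∑-linear (sublists es)) (term m fᵢⱼ) (term m fⱼᵢ))
             (cong₂ _+_ (∑-sublists-orientations es fᵢⱼ) (∑-sublists-orientations es fⱼᵢ))) ⟩
      p * (orientSum es fᵢⱼ + orientSum es fⱼᵢ) ∎

  -- Edges between the two colour classes contribute the factor q + p = 1.
  orientSum-headsAvoid : (c : Fin n → Bool) (es : List (Arc n)) (g : List (Arc n) → ℚ) →
    orientSum es (λ D → ⟦ headsAvoid c D ⟧ * g (within (not ∘ c) D)) ≡
    pow q (length (within c es)) * orientSum (within (not ∘ c) es) g
  orientSum-headsAvoid c []             g = refl
  orientSum-headsAvoid c ((i , j) ∷ es) g = step (c i) (c j) refl refl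
    where
    l : ℕ
    l = length (within c es)
    rest : List (Arc _)
    rest = within (not ∘ c) es
    Y : ℚ
    Y = orientSum rest g
    vanish : orientSum es (λ D → 0ℚ * g (within (not ∘ c) D)) ≡ 0ℚ
    vanish = trans (L-* (orientSum-linear es) 0ℚ (λ D → g (within (not ∘ c) D))) (ℚP.*-zeroˡ (orientSum es (λ D → g (within (not ∘ c) D))))
    cross : ∀ x → q * x + p * x ≡ x
    cross x = trans (sym (ℚP.*-distribʳ-+ x q p)) (trans (cong (_* x) q+p≡1) (ℚP.*-identityˡ x))
    step : ∀ a b → c i ≡ a → c j ≡ b →
      orientSum ((i , j) ∷ es) (λ D → ⟦ headsAvoid c D ⟧ * g (within (not ∘ c) D)) ≡
      pow q (length (within c ((i , j) ∷ es))) * orientSum (within (not ∘ c) ((i , j) ∷ es)) g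
    -- An edge inside the class has its head there in either direction, so only its absence remains.
    step true  true  ci cj rewrite ci | cj = begin
      _
        ≡⟨ cong₂ (λ x z → q * x + p * (z + z)) (orientSum-headsAvoid c es g) vanish ⟩
      q * (pow q l * Y) + p * (0ℚ + 0ℚ)
        ≡⟨ solve 4 (λ p q a b → q :* (a :* b) :+ p :* (con 0ℚ :+ con 0ℚ) := q :* a :* b) refl p q (pow q l) Y ⟩
      q * pow q l * Y ∎
    step true  false ci cj rewrite ci | cj = begin
      _
        ≡⟨ cong₂ (λ x z → q * x + p * (x + z)) (orientSum-headsAvoid c es g) vanish ⟩
      q * (pow q l * Y) + p * (pow q l * Y + 0ℚ)
        ≡⟨ cong (λ x → q * (pow q l * Y) + p * x) (ℚP.+-identityʳ (pow q l * Y)) ⟩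
      q * (pow q l * Y) + p * (pow q l * Y)
        ≡⟨ cross (pow q l * Y) ⟩
      pow q l * Y ∎
    step false true  ci cj rewrite ci | cj = begin
      _
        ≡⟨ cong₂ (λ x z → q * x + p * (z + x)) (orientSum-headsAvoid c es g) vanish ⟩
      q * (pow q l * Y) + p * (0ℚ + pow q l * Y)
        ≡⟨ cong (λ x → q * (pow q l * Y) + p * x) (ℚP.+-identityˡ (pow q l * Y)) ⟩
      q * (pow q l * Y) + p * (pow q l * Y)
        ≡⟨ cross (pow q l * Y) ⟩
      pow q l * Y ∎
    -- The edge survives the restriction. The induction hypothesis is used for `g` and for `g` with
    -- either direction of the edge added, which is why `g` is arbitrary.
    step false false ci cj rewrite ci | cj = begin
      _
        ≡⟨ cong₂ (λ x y → q * x + p * y) (orientSum-headsAvoid c es g)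
             (cong₂ _+_ (orientSum-headsAvoid c es (λ D → g ((i , j) ∷ D))) (orientSum-headsAvoid c es (λ D → g ((j , i) ∷ D)))) ⟩
      q * (pow q l * Y) + p * (pow q l * orientSum rest (λ D → g ((i , j) ∷ D)) + pow q l * orientSum rest (λ D → g ((j , i) ∷ D)))
        ≡⟨ solve 6 (λ p q a y u v → q :* (a :* y) :+ p :* (a :* u :+ a :* v) := a :* (q :* y :+ p :* (u :+ v))) refl
             p q (pow q l) Y (orientSum rest (λ D → g ((i , j) ∷ D))) (orientSum rest (λ D → g ((j , i) ∷ D))) ⟩
      pow q l * (q * Y + p * (orientSum rest (λ D → g ((i , j) ∷ D)) + orientSum rest (λ D → g ((j , i) ∷ D)))) ∎

  acyclicSum : List (Fin n) → ℚ
  acyclicSum vs = orientSum (pairsOf vs) (λ D → ⟦ acyclic D ⟧)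

  -- Colour the vertices by membership in `S`. Being sources becomes a condition on heads,
  -- acyclicity is then decided on `R` alone, and `orientSum-headsAvoid` separates the factor `q` of
  -- each pair inside `S`.
  acyclicSum-sources : {S R vs : List (Fin n)} → Unique vs → Interleaving S R vs →
    pow q (length S C 2) * acyclicSum R ≡ orientSum (pairsOf vs) (λ D → ⟦ all (isSource D) S ⟧ * ⟦ acyclic D ⟧)
  acyclicSum-sources {S = S} {R} {vs} uniq sp = sym (begin
    orientSum (pairsOf vs) (λ D → ⟦ all (isSource D) S ⟧ * ⟦ acyclic D ⟧)
      ≡⟨ L-cong (orientSum-linear (pairsOf vs)) (λ D → restrictTo D) ⟩
    orientSum (pairsOf vs) (λ D → ⟦ headsAvoid (mem S) D ⟧ * ⟦ acyclic (within (not ∘ mem S) D) ⟧)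
      ≡⟨ orientSum-headsAvoid (mem S) (pairsOf vs) (λ D → ⟦ acyclic D ⟧) ⟩
    pow q (length (within (mem S) (pairsOf vs))) * orientSum (within (not ∘ mem S) (pairsOf vs)) (λ D → ⟦ acyclic D ⟧)
      ≡⟨ cong₂ (λ es fs → pow q (length es) * orientSum fs (λ D → ⟦ acyclic D ⟧))
           (trans (within-pairsOf (mem S) vs) (cong pairsOf (proj₁ (filter-mem uniq sp))))
           (trans (within-pairsOf (not ∘ mem S) vs) (cong pairsOf (proj₂ (filter-mem uniq sp)))) ⟩
    pow q (length (pairsOf S)) * acyclicSum R
      ≡⟨ cong (λ k → pow q k * acyclicSum R) (length-pairsOf S) ⟩
    pow q (length S C 2) * acyclicSum R ∎)
    where
    restrictTo : ∀ D → ⟦ all (isSource D) S ⟧ * ⟦ acyclic D ⟧ ≡ ⟦ headsAvoid (mem S) D ⟧ * ⟦ acyclic (within (not ∘ mem S) D) ⟧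
    restrictTo D rewrite sym (headsAvoid-mem S D) with headsAvoid (mem S) D in eq
    ... | true  = cong (λ b → 1ℚ * ⟦ b ⟧) (sym (acyclic-within (mem S) D (Equivalence.from BoolP.T-≡ eq)))
    ... | false = trans (ℚP.*-zeroˡ ⟦ acyclic D ⟧) (sym (ℚP.*-zeroˡ ⟦ acyclic (within (not ∘ mem S) D) ⟧))

  -- This expands the product of `1 - ⟦ b x ⟧` over `xs`: each `x` goes to `S` with factor
  -- `- ⟦ b x ⟧` or to `R` with factor 1.
  ∑-splits-sign : (b : A → Bool) (xs : List A) →
    ∑ (splits xs) (λ (S , R) → pow (- 1ℚ) (length S) * ⟦ all b S ⟧) ≡ ⟦ all (not ∘ b) xs ⟧
  ∑-splits-sign b []       = refl
  ∑-splits-sign {A = A} b (x ∷ xs) = begin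
    ∑ (splits (x ∷ xs)) (λ (S , R) → pow (- 1ℚ) (length S) * ⟦ all b S ⟧)
      ≡⟨ ∑-splits-∷ x xs _ ⟩
    ∑ (splits xs) (λ (S , R) → - 1ℚ * pow (- 1ℚ) (length S) * ⟦ b x ∧ all b S ⟧) + ∑ (splits xs) f
      ≡⟨ cong (_+ ∑ (splits xs) f) (∑-cong (splits xs) (λ (S , R) → trans
           (cong (- 1ℚ * pow (- 1ℚ) (length S) *_) (⟦∧⟧ (b x) (all b S)))
           (solve 4 (λ m s u v → m :* s :* (u :* v) := (m :* u) :* (s :* v)) refl (- 1ℚ) (pow (- 1ℚ) (length S)) ⟦ b x ⟧ ⟦ all b S ⟧))) ⟩
    ∑ (splits xs) (λ sr → (- 1ℚ * ⟦ b x ⟧) * f sr) + ∑ (splits xs) f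
      ≡⟨ cong (_+ ∑ (splits xs) f) (L-* (∑-linear (splits xs)) (- 1ℚ * ⟦ b x ⟧) f) ⟩
    (- 1ℚ * ⟦ b x ⟧) * ∑ (splits xs) f + ∑ (splits xs) f
      ≡⟨ cong (λ y → (- 1ℚ * ⟦ b x ⟧) * y + y) (∑-splits-sign b xs) ⟩
    (- 1ℚ * ⟦ b x ⟧) * ⟦ all (not ∘ b) xs ⟧ + ⟦ all (not ∘ b) xs ⟧
      ≡⟨ combine (b x) (all (not ∘ b) xs) ⟩
    ⟦ not (b x) ∧ all (not ∘ b) xs ⟧ ∎
    where
    f : List A × List A → ℚ
    f (S , R) = pow (- 1ℚ) (length S) * ⟦ all b S ⟧
    combine : ∀ a c → (- 1ℚ * ⟦ a ⟧) * ⟦ c ⟧ + ⟦ c ⟧ ≡ ⟦ not a ∧ c ⟧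
    combine true  true  = refl
    combine true  false = refl
    combine false true  = refl
    combine false false = refl

  -- Inclusion-exclusion over sets S of sources: an acyclic orientation of a nonempty graph has a source.
  ∑-splits-acyclicSum : (v : Fin n) (vs : List (Fin n)) → Unique (v ∷ vs) →
    ∑ (splits (v ∷ vs)) (λ (S , R) → pow (- 1ℚ) (length S) * pow q (length S C 2) * acyclicSum R) ≡ 0ℚ
  ∑-splits-acyclicSum {n} v vs uniq = begin
    ∑ (splits us) (λ (S , R) → pow (- 1ℚ) (length S) * pow q (length S C 2) * acyclicSum R)
      ≡⟨ ∑-splits-cong us (λ {S} {R} sp → trans (ℚP.*-assoc (pow (- 1ℚ) (length S)) (pow q (length S C 2)) (acyclicSum R))
           (trans (cong (pow (- 1ℚ) (length S) *_) (acyclicSum-sources uniq sp))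
                  (sym (L-* (orientSum-linear es) (pow (- 1ℚ) (length S)) (λ D → ⟦ all (isSource D) S ⟧ * ⟦ acyclic D ⟧))))) ⟩
    ∑ (splits us) (λ (S , R) → orientSum es (λ D → pow (- 1ℚ) (length S) * (⟦ all (isSource D) S ⟧ * ⟦ acyclic D ⟧)))
      ≡⟨ ∑-interchange (orientSum-linear es) (splits us) (λ D (S , R) → pow (- 1ℚ) (length S) * (⟦ all (isSource D) S ⟧ * ⟦ acyclic D ⟧)) ⟨
    orientSum es (λ D → ∑ (splits us) (λ (S , R) → pow (- 1ℚ) (length S) * (⟦ all (isSource D) S ⟧ * ⟦ acyclic D ⟧)))
      -- All arcs of `D` join vertices of `us`, a property preserved by reversal; walking backwards
      -- thus never leaves `us`.
      ≡⟨ orientSum-cong-All swap (pairsOf-∈ us) (λ D inside → trans (collect D) (vanish D inside)) ⟩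
    orientSum es (λ D → 0ℚ)
      ≡⟨ L-0 (orientSum-linear es) ⟩
    0ℚ ∎
    where
    us : List (Fin n)
    us = v ∷ vs
    es : List (Arc n)
    es = pairsOf us
    collect : ∀ D → ∑ (splits us) (λ (S , R) → pow (- 1ℚ) (length S) * (⟦ all (isSource D) S ⟧ * ⟦ acyclic D ⟧)) ≡
      ⟦ acyclic D ⟧ * ⟦ all (not ∘ isSource D) us ⟧
    collect D = begin
      ∑ (splits us) (λ (S , R) → pow (- 1ℚ) (length S) * (⟦ all (isSource D) S ⟧ * ⟦ acyclic D ⟧))
        ≡⟨ ∑-cong (splits us) (λ (S , R) → solve 3 (λ a b c → a :* (b :* c) := c :* (a :* b)) refl (pow (- 1ℚ) (length S)) ⟦ all (isSource D) S ⟧ ⟦ acyclic D ⟧) ⟩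
      ∑ (splits us) (λ (S , R) → ⟦ acyclic D ⟧ * (pow (- 1ℚ) (length S) * ⟦ all (isSource D) S ⟧))
        ≡⟨ L-* (∑-linear (splits us)) ⟦ acyclic D ⟧ (λ (S , R) → pow (- 1ℚ) (length S) * ⟦ all (isSource D) S ⟧) ⟩
      ⟦ acyclic D ⟧ * ∑ (splits us) (λ (S , R) → pow (- 1ℚ) (length S) * ⟦ all (isSource D) S ⟧)
        ≡⟨ cong (⟦ acyclic D ⟧ *_) (∑-splits-sign (isSource D) us) ⟩
      ⟦ acyclic D ⟧ * ⟦ all (not ∘ isSource D) us ⟧ ∎
    vanish : ∀ D → All (λ (u , w) → u ∈ us × w ∈ us) D → ⟦ acyclic D ⟧ * ⟦ all (not ∘ isSource D) us ⟧ ≡ 0ℚ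
    vanish D inside with all (not ∘ isSource D) us in eq
    ... | false = ℚP.*-zeroʳ ⟦ acyclic D ⟧
    ... | true  = cong (λ b → ⟦ not b ⟧ * 1ℚ) (Equivalence.to BoolP.T-≡
                    (cyclic⁺ {D = D} (noSource⇒cyclic inside (Equivalence.from BoolP.T-≡ eq) (here refl))))

  acyclicSum-[] : acyclicSum {n} [] ≡ 1ℚ
  acyclicSum-[] {n} = cong (λ b → ⟦ not b ⟧) (T-ext {b = false} (λ t → noWalk (proj₂ (proj₂ (proj₂ (cyclic⁻ {n} [] t))))) (λ ()))
    where
    noWalk : ∀ {k u v} → Walk {n} [] (suc k) u v → T false
    noWalk (() ∷ _)

  expected≡acyclicSum : ∀ n →
    ∑ (graphs n) (λ G → pow p (length G) * pow q (n C 2 ∸ length G) * fromℕℚ (numAcyclicOrientations G)) ≡ acyclicSum (allFin n)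
  expected≡acyclicSum n = begin
    ∑ (graphs n) (λ G → pow p (length G) * pow q (n C 2 ∸ length G) * fromℕℚ (numAcyclicOrientations G))
      ≡⟨ ∑-cong (graphs n) (λ G → cong₂ (λ l x → pow p (length G) * pow q (l ∸ length G) * x) edges (count G)) ⟩
    ∑ (graphs n) (λ G → graphWeight (length (pairs n)) (length G) * ∑ (orientations G) (λ D → ⟦ acyclic D ⟧))
      ≡⟨ ∑-sublists-orientations (pairs n) (λ D → ⟦ acyclic D ⟧) ⟩
    orientSum (pairs n) (λ D → ⟦ acyclic D ⟧)
      ≡⟨ cong (λ es → orientSum es (λ D → ⟦ acyclic D ⟧)) (pairs≡pairsOf n) ⟩
    acyclicSum (allFin n) ∎
    where
    edges : n C 2 ≡ length (pairs n)
    edges = sym (trans (cong length (pairs≡pairsOf n)) (trans (length-pairsOf (allFin n)) (cong (_C 2) (length-allFin n))))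
    count : ∀ G → fromℕℚ (numAcyclicOrientations G) ≡ ∑ (orientations G) (λ D → ⟦ acyclic D ⟧)
    count G = trans (fromℕℚ-length (filter (λ D → acyclic D Bool.≟ true) (orientations G)))
      (trans (∑-filter acyclic (orientations G) (λ _ → 1ℚ)) (∑-cong (orientations G) (λ D → ℚP.*-identityʳ ⟦ acyclic D ⟧)))

-- Equality of the solutions of the two recursions

unique-interleavingʳ : {S R xs : List A} → Interleaving S R xs → Unique xs → Unique R
unique-interleavingʳ []         []            = []
unique-interleavingʳ (consˡ sp) (_ ∷ uniq)    = unique-interleavingʳ sp uniq
unique-interleavingʳ (consʳ sp) (x≢xs ∷ uniq) = proj₂ (interleaving-All sp x≢xs) ∷ unique-interleavingʳ sp uniq

module Comparison (p q r : ℚ) (q+p≡1 : q + p ≡ 1ℚ) (q*r≡1 : q * r ≡ 1ℚ) (N : ℕ) where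
  open OrientationSums p q q+p≡1
  open ParkingSums p q r q+p≡1 q*r≡1 N
  open +-*-Solver using (solve; _:=_; _:+_; _:*_; con)

  -- Both sides satisfy the same recursion, in which the S = [] term has coefficient 1.
  acyclicSum≡scaledParkSum : ∀ k (vs : List (Fin n)) → length vs ≤ k → length vs ≤ N → Unique vs →
    acyclicSum vs ≡ scaledParkSum (length vs)
  -- On the empty vertex set `scaledParkSum 0` evaluates to 1.
  acyclicSum≡scaledParkSum {n} k [] _ _ _ = acyclicSum-[] {n}
  acyclicSum≡scaledParkSum {n} (suc k) us@(v ∷ vs) (s≤s |vs|≤k) len uniq =
    begin
    acyclicSum us
      ≡⟨ solve 2 (λ a b → a := (a :+ con (- 1ℚ) :* b) :+ b) refl (acyclicSum us) (scaledParkSum (length us)) ⟩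
    diff us + scaledParkSum (length us)
      ≡⟨ cong (_+ scaledParkSum (length us)) diff≡0 ⟩
    0ℚ + scaledParkSum (length us)
      ≡⟨ ℚP.+-identityˡ (scaledParkSum (length us)) ⟩
    scaledParkSum (length us) ∎
    where
    diff : List (Fin n) → ℚ
    diff R = acyclicSum R + - 1ℚ * scaledParkSum (length R)
    κ : List (Fin n) → ℚ
    κ S = pow (- 1ℚ) (length S) * pow q (length S C 2)
    -- `R` is not a structural part of `us`, so the induction descends on the length bound `k`.
    smaller : ∀ {S R} → Interleaving S R us → length R ℕ.< length us → κ S * diff R ≡ 0ℚ
    smaller {S} {R} sp lt = begin
      κ S * diff R
        ≡⟨ cong (λ a → κ S * (a + - 1ℚ * scaledParkSum (length R)))
             (acyclicSum≡scaledParkSum k R (ℕP.≤-trans (ℕP.≤-pred lt) |vs|≤k) (ℕP.≤-trans (ℕP.<⇒≤ lt) len) (unique-interleavingʳ sp uniq)) ⟩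
      κ S * (scaledParkSum (length R) + - 1ℚ * scaledParkSum (length R))
        ≡⟨ solve 2 (λ s b → s :* (b :+ con (- 1ℚ) :* b) := con 0ℚ) refl (κ S) (scaledParkSum (length R)) ⟩
      0ℚ ∎
    diff≡0 : diff us ≡ 0ℚ
    diff≡0 = begin
      diff us
        ≡⟨ ℚP.*-identityˡ (diff us) ⟨
      κ [] * diff us
        ≡⟨ ∑-splits-leading us (λ (S , R) → κ S * diff R) smaller ⟨
      ∑ (splits us) (λ (S , R) → κ S * diff R)
        ≡⟨ ∑-cong (splits us) (λ (S , R) → solve 3 (λ s a b → s :* (a :+ con (- 1ℚ) :* b) := s :* a :+ con (- 1ℚ) :* (s :* b)) refl
             (κ S) (acyclicSum R) (scaledParkSum (length R))) ⟩
      ∑ (splits us) (λ (S , R) → κ S * acyclicSum R + - 1ℚ * (κ S * scaledParkSum (length R)))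
        ≡⟨ L-+ (∑-linear (splits us)) (λ (S , R) → κ S * acyclicSum R) (λ (S , R) → - 1ℚ * (κ S * scaledParkSum (length R))) ⟩
      ∑ (splits us) (λ (S , R) → κ S * acyclicSum R) + ∑ (splits us) (λ (S , R) → - 1ℚ * (κ S * scaledParkSum (length R)))
        ≡⟨ cong₂ _+_ (∑-splits-acyclicSum v vs uniq)
             (trans (L-* (∑-linear (splits us)) (- 1ℚ) (λ (S , R) → κ S * scaledParkSum (length R)))
                    (cong (- 1ℚ *_) (∑-splits-scaledParkSum v vs len))) ⟩
      0ℚ + - 1ℚ * 0ℚ
        ≡⟨⟩
      0ℚ ∎

  ∑-Park : ∀ k → ∑ (filter (λ a → isParking a Bool.≟ true) (vecsBelow N k)) (λ a → pow r (Area a) * pow p (suppSize a)) ≡ parkSum k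
  ∑-Park k = begin
    ∑ (filter (λ a → isParking a Bool.≟ true) (vecsBelow N k)) (λ a → pow r (Area a) * pow p (suppSize a))
      ≡⟨ ∑-filter isParking (vecsBelow N k) _ ⟩
    ∑ (vecsBelow N k) (λ a → ⟦ isParking a ⟧ * (pow r (Area a) * pow p (suppSize a)))
      ≡⟨ ∑-cong (vecsBelow N k) (λ a → cong (⟦ isParking a ⟧ *_) (weight-toList a)) ⟨
    ∑ (vecsBelow N k) (λ a → ⟦ park (toList a) ⟧ * weight (toList a))
      ≡⟨ ∑-vecsBelow N k (λ a → ⟦ park a ⟧ * weight a) ⟩
    parkSum k ∎

-- Specialisation to `q = 1 - p` and its inverse

inv-inverseʳ : ∀ {x} → x ≢ 0ℚ → x * inv x ≡ 1ℚ
inv-inverseʳ {x} x≢0 with x ℚP.≟ 0ℚ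
... | yes x≡0 = contradiction x≡0 x≢0
... | no  x≢0′ = ℚP.*-inverseʳ x {{ℚ.≢-nonZero x≢0′}}

theorem5p17 : (n : ℕ) → 1 ≤ n → (p : ℚ) → 0ℚ < p → p < 1ℚ →
    expectedAcyclicOrientations n p
    ≡ pow (1ℚ - p) (n C 2)
    * sumℚ (map (λ a → pow (inv (1ℚ - p)) (Area a) * pow p (suppSize a)) (Park n))
theorem5p17 n _ p _ p<1 = begin
  expectedAcyclicOrientations n p
    ≡⟨ expected≡acyclicSum n ⟩
  acyclicSum (allFin n)
    ≡⟨ acyclicSum≡scaledParkSum n (allFin n) (ℕP.≤-reflexive (length-allFin n)) (ℕP.≤-reflexive (length-allFin n)) (allFin⁺ n) ⟩
  scaledParkSum (length (allFin n))
    ≡⟨ cong scaledParkSum (length-allFin n) ⟩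
  pow q (n C 2) * parkSum n
    ≡⟨ cong (pow q (n C 2) *_) (∑-Park n) ⟨
  pow q (n C 2) * ∑ (Park n) (λ a → pow (inv q) (Area a) * pow p (suppSize a)) ∎
  where
  q : ℚ
  q = 1ℚ - p
  q+p≡1 : q + p ≡ 1ℚ
  q+p≡1 = trans (ℚP.+-assoc 1ℚ (- p) p) (trans (cong (1ℚ +_) (ℚP.+-inverseˡ p)) (ℚP.+-identityʳ 1ℚ))
  q≢0 : q ≢ 0ℚ
  q≢0 q≡0 = ℚP.<⇒≢ p<1 (trans (sym (ℚP.+-identityˡ p)) (trans (cong (_+ p) (sym q≡0)) q+p≡1))
  open OrientationSums p q q+p≡1
  -- The entry bound `N` is taken to be `n`, the bound built into `Park n`.
  open ParkingSums p q (inv q) q+p≡1 (inv-inverseʳ q≢0) n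
  open Comparison p q (inv q) q+p≡1 (inv-inverseʳ q≢0) n
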